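{- Suppose that $\theta$ is a large enough regular cardinal, that $(X,\tau)\in H(\theta)$ is a topological space for which player $\mathrm{II}$ has a winning strategy in the Rothberger game on $X$, and that $\mathbb{P}\in H(\theta)$ is a poset. Suppose further that the set of countable $M\prec H(\theta)$ such that $\mathbb{P}$ is strongly proper for $M$ is stationary in $[H(\theta)]^{\aleph_0}$. Then $\mathbb{P}$ forces that $\mathrm{II}$ has a winning strategy in the Rothberger game on $(X,\tau)$.
   Context: $H(\theta)$ is the collection of sets hereditarily of cardinality $<\theta$; "large enough" has its usual meaning ($\theta\ge\omega_2$ and $H(\theta)$ contains all relevant objects, such as power sets, topologies, and names built from $\mathbb{P}$ and $X$). Strong properness. Let $M\prec H(\theta)$ be countable with $\mathbb{P}\in M$. For $q\in\mathbb{P}$, a condition $\bar q\in M\cap\mathbb{P}$ is a residue of $q$ to $M$ if every $s\le\bar q$ with $s\in M$ is compatible with $q$. A condition $p\in\mathbb{P}$ is $(M,\mathbb{P})$-strongly generic if every $q\le p$ has a residue to $M$. $\mathbb{P}$ is strongly proper for $M$ if every $s\in M\cap\mathbb{P}$ can be extended to an $(M,\mathbb{P})$-strongly generic condition. Preservation. If $G$ is $V$-generic over $\mathbb{P}$, then $\tau^G$ denotes the topology on $X$ in $V[G]$ having $\tau$ as a basis. "$\mathbb{P}$ forces that $(X,\tau)$ has property $\Phi$" means that every condition forces that $(X,\tau^{\dot G})$ has property $\Phi$. Rothberger game on a space $X$: in round $n\in\omega$, player $\mathrm{I}$ plays an open cover $\mathcal{U}_n$ of $X$ and player $\mathrm{II}$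 responds with some $U_n\in\mathcal{U}_n$. $\mathrm{II}$ wins if $\{U_n:n\in\omega\}$ covers $X$; otherwise $\mathrm{I}$ wins. A strategy for $\mathrm{II}$ is a function $\sigma$ assigning to each finite nonempty sequence $(\mathcal{U}_0,\dots,\mathcal{U}_n)$ of open covers an element $\sigma(\mathcal{U}_0,\dots,\mathcal{U}_n)\in\mathcal{U}_n$; it is winning if for every sequence $\langle\mathcal{U}_n:n\in\omega\rangle$ of open covers, $\{\sigma(\mathcal{U}_0,\dots,\mathcal{U}_n):n\in\omega\}$ covers $X$. -}

module Defs where

open import Level using (0ℓ; Lift) renaming (suc to lsuc)
open import Data.Nat using (ℕ; zero; suc)
open import Data.Fin using (Fin)
open import Data.Vec.Functional using (Vector; _∷_)
open import Data.Bool using (Bool; true; false; T)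
open import Data.Empty using (⊥; ⊥-elim)
open import Data.Maybe using (Maybe; just; nothing)
open import Data.Product using (Σ; Σ-syntax; ∃; ∃-syntax; _×_; _,_; proj₁; proj₂)
open import Data.Sum using (_⊎_)
open import Function using (_∘_)
open import Function.Bundles using (_⇔_)
open import Relation.Nullary using (¬_)

-- An interpretation of the first-order language of set theory: a domain,
-- truth values, and a meaning for each atomic formula, connective and
-- quantifier.  It is used twice: for truth in the universe V and for the
-- forcing relation, so that "II has a winning strategy in V" and "p forces
-- that II has a winning strategy" interpret one and the same formula.

record Interpretation : Set₃ where
  infix  7 _∈_ _≐_
  infixr 6 _∧_
  infixr 5 _∨_
  infixr 4 _⇒_
  field
    Dom            : Set₁
    Ω              : Set₂
    _∈_ _≐_        : Dom → Dom → Ω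
    falsum         : Ω
    _∧_ _∨_ _⇒_    : Ω → Ω → Ω
    all some       : (Dom → Ω) → Ω

module Language (𝓘 : Interpretation) where
  open Interpretation 𝓘

  infix 3 all-syntax some-syntax all∈-syntax some∈-syntax
  infix 4 _iff_
  infix 7 _⊆_

  all-syntax some-syntax : (Dom → Ω) → Ω
  all-syntax  = all
  some-syntax = some

  all∈-syntax some∈-syntax : Dom → (Dom → Ω) → Ω
  all∈-syntax  a φ = all  λ x → x ∈ a ⇒ φ x
  some∈-syntax a φ = some λ x → x ∈ a ∧ φ x

  syntax all-syntax    (λ x → φ)   = ⋀[ x ] φ
  syntax some-syntax   (λ x → φ)   = ⋁[ x ] φ
  syntax all∈-syntax  a (λ x → φ)  = ⋀[ x ∶ a ] φ
  syntax some∈-syntax a (λ x → φ)  = ⋁[ x ∶ a ] φ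

  _iff_ : Ω → Ω → Ω
  φ iff ψ = (φ ⇒ ψ) ∧ (ψ ⇒ φ)

  _⊆_ : Dom → Dom → Ω
  a ⊆ b = ⋀[ x ∶ a ] (x ∈ b)

  Empty : Dom → Ω
  Empty a = ⋀[ x ] (x ∈ a ⇒ falsum)

  -- z = {a , b}
  UPair : Dom → Dom → Dom → Ω
  UPair z a b = ⋀[ w ] (w ∈ z iff (w ≐ a ∨ w ≐ b))

  -- z = ⟨a , b⟩ = {{a} , {a , b}}
  OPair : Dom → Dom → Dom → Ω
  OPair z a b = ⋁[ u ] ⋁[ v ] (UPair u a a ∧ UPair v a b ∧ UPair z u v)

  -- w = ⋃ s
  Union : Dom → Dom → Ω
  Union w s = ⋀[ x ] (x ∈ w iff (⋁[ u ∶ s ] (x ∈ u)))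

  -- w = u ∩ v
  Inter : Dom → Dom → Dom → Ω
  Inter w u v = ⋀[ x ] (x ∈ w iff (x ∈ u ∧ x ∈ v))

  -- ⟨x , y⟩ ∈ f
  App : Dom → Dom → Dom → Ω
  App f x y = ⋁[ z ∶ f ] OPair z x y

  -- f is a function with domain d
  Function : Dom → Dom → Ω
  Function f d =
      (⋀[ z ∶ f ] ⋁[ x ∶ d ] ⋁[ y ] OPair z x y)
    ∧ (⋀[ x ∶ d ] ⋁[ y ] App f x y)
    ∧ (⋀[ x ] ⋀[ y ] ⋀[ y′ ] (App f x y ⇒ App f x y′ ⇒ y ≐ y′))

  -- g = f ↾ d
  Restriction : Dom → Dom → Dom → Ω
  Restriction g f d =
    ⋀[ z ] (z ∈ g iff (z ∈ f ∧ (⋁[ x ∶ d ] ⋁[ y ] OPair z x y)))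

  -- m = n ∪ {n}
  Succ : Dom → Dom → Ω
  Succ n m = ⋀[ x ] (x ∈ m iff (x ∈ n ∨ x ≐ n))

  Inductive : Dom → Ω
  Inductive w =
    (⋁[ e ∶ w ] Empty e) ∧ (⋀[ n ∶ w ] ⋁[ m ∶ w ] Succ n m)

  Omega : Dom → Ω
  Omega w = Inductive w ∧ (⋀[ v ] (Inductive v ⇒ w ⊆ v))

  Topology : Dom → Dom → Ω
  Topology X τ =
      (⋀[ u ∶ τ ] (u ⊆ X))
    ∧ (⋁[ e ∶ τ ] Empty e)
    ∧ X ∈ τ
    ∧ (⋀[ u ∶ τ ] ⋀[ v ∶ τ ] ⋁[ w ∶ τ ] Inter w u v)
    ∧ (⋀[ s ] (s ⊆ τ ⇒ (⋁[ w ∶ τ ] Union w s)))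

  -- B is a basis of the topology τ
  Basis : Dom → Dom → Ω
  Basis B τ =
    B ⊆ τ ∧ (⋀[ u ∶ τ ] ⋀[ x ∶ u ] ⋁[ b ∶ B ] (x ∈ b ∧ b ⊆ u))

  OpenCover : Dom → Dom → Dom → Ω
  OpenCover X τ 𝒰 = 𝒰 ⊆ τ ∧ (⋀[ x ∶ X ] ⋁[ u ∶ 𝒰 ] (x ∈ u))

  -- s is a sequence of open covers indexed by d
  CoverSequence : Dom → Dom → Dom → Dom → Ω
  CoverSequence X τ s d =
    Function s d ∧ (⋀[ i ] ⋀[ 𝒰 ] (App s i 𝒰 ⇒ OpenCover X τ 𝒰))

  -- The finite nonempty sequence (𝒰₀,…,𝒰ₙ) is a function with domain
  -- m = n ∪ {n}.  σ is a strategy when its domain is the set of all these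
  -- and σ(𝒰₀,…,𝒰ₙ) ∈ 𝒰ₙ.
  Strategy : Dom → Dom → Dom → Dom → Ω
  Strategy X τ ω σ =
      (⋁[ d ] ( (⋀[ s ] (s ∈ d iff
                   (⋁[ n ∶ ω ] ⋁[ m ] (Succ n m ∧ CoverSequence X τ s m))))
              ∧ Function σ d))
    ∧ (⋀[ n ∶ ω ] ⋀[ m ] ⋀[ s ]
         (Succ n m ⇒ CoverSequence X τ s m ⇒
           (⋁[ u ] ⋁[ 𝒰 ] (App σ s u ∧ App s n 𝒰 ∧ u ∈ 𝒰))))

  Winning : Dom → Dom → Dom → Dom → Ω
  Winning X τ ω σ =
    ⋀[ f ] (CoverSequence X τ f ω ⇒
      (⋀[ x ∶ X ] ⋁[ n ∶ ω ] ⋁[ m ] ⋁[ s ] ⋁[ u ]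
        (Succ n m ∧ Restriction s f m ∧ App σ s u ∧ x ∈ u)))

  -- II has a winning strategy in the Rothberger game on (X , τ)
  IIWinsRothberger : Dom → Dom → Ω
  IIWinsRothberger X τ =
    ⋁[ ω ] (Omega ω ∧ (⋁[ σ ] (Strategy X τ ω σ ∧ Winning X τ ω σ)))

  -- II has a winning strategy on X with the topology having B as a basis
  IIWinsRothbergerGeneratedBy : Dom → Dom → Ω
  IIWinsRothbergerGeneratedBy X B =
    ⋁[ τ ] (Topology X τ ∧ Basis B τ ∧ IIWinsRothberger X τ)

-- The universe of sets: Aczel's iterative sets, with extensional equality.
-- It satisfies ZF under excluded middle; choice is the principle
-- AxiomOfChoice below.

data V : Set₁ where
  sup : (I : Set) → (I → V) → V

Index : V → Set
Index (sup I f) = I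

infixl 9 _!_
_!_ : (a : V) → Index a → V
sup I f ! i = f i

_≈_ : V → V → Set₁
sup I f ≈ sup J g =
    (∀ i → ∃[ j ] (f i ≈ g j))
  × (∀ j → ∃[ i ] (f i ≈ g j))

_∈ᵛ_ : V → V → Set₁
a ∈ᵛ b = ∃[ j ] (a ≈ (b ! j))

𝕍 : Interpretation
𝕍 = record
  { Dom    = V
  ; Ω      = Set₁
  ; _∈_    = _∈ᵛ_
  ; _≐_    = _≈_
  ; falsum = Lift (lsuc 0ℓ) ⊥
  ; _∧_    = _×_
  ; _∨_    = _⊎_
  ; _⇒_    = λ A B → A → B
  ; all    = λ A → ∀ x → A x
  ; some   = λ A → ∃[ x ] A x
  }

open Language 𝕍 public
  using (_⊆_; Function; App; Topology; IIWinsRothberger)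

infix 7 _∈_
_∈_ : V → V → Set₁
_∈_ = _∈ᵛ_

AxiomOfChoice : Set₁
AxiomOfChoice =
  ∀ a → (∀ x → x ∈ a → ∃[ y ] y ∈ x) →
  ∃[ f ] (Function f a × (∀ x y → x ∈ a → App f x y → y ∈ x))

∅ : V
∅ = sup ⊥ ⊥-elim

⁅_,_⁆ : V → V → V
⁅ a , b ⁆ = sup Bool λ { true → a ; false → b }

⟪_,_⟫ : V → V → V
⟪ a , b ⟫ = ⁅ ⁅ a , a ⁆ , ⁅ a , b ⁆ ⁆

⋃ : V → V
⋃ a = sup (Σ[ i ∈ Index a ] Index (a ! i)) λ { (i , j) → a ! i ! j }

_×ᵛ_ : V → V → V
a ×ᵛ b = sup (Index a × Index b) λ { (i , j) → ⟪ a ! i , b ! j ⟫ }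

-- Under excluded middle every subset of a is cut out by a Boolean-valued
-- function on indices.
𝒫 : V → V
𝒫 a = sup (Index a → Bool) λ χ →
        sup (Σ[ i ∈ Index a ] T (χ i)) λ { (i , _) → a ! i }

-- The transitive closure a ∪ ⋃ a ∪ ⋃ ⋃ a ∪ ⋯
trcl : V → V
trcl (sup I f) = sup (Σ[ i ∈ I ] Maybe (Index (trcl (f i)))) λ where
  (i , nothing) → f i
  (i , just j)  → trcl (f i) ! j

numeral : ℕ → V
numeral zero    = ∅
numeral (suc n) = ⋃ ⁅ numeral n , ⁅ numeral n , numeral n ⁆ ⁆

ω : V
ω = sup ℕ numeral

Maps : V → V → V → Set₁
Maps f a b = Function f a × (∀ x y → App f x y → y ∈ b)

-- ∣a∣ ≤ ∣b∣
_≼_ : V → V → Set₁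
a ≼ b = ∃[ f ] (Maps f a b × (∀ x x′ y → App f x y → App f x′ y → x ≈ x′))

Countable : V → Set₁
Countable a = a ≼ ω

Transitive : V → Set₁
Transitive a = ∀ x → x ∈ a → x ⊆ a

-- In the presence of foundation, ordinals are the transitive sets of
-- transitive sets.
Ordinal : V → Set₁
Ordinal α = Transitive α × (∀ β → β ∈ α → Transitive β)

Cardinal : V → Set₁
Cardinal κ = Ordinal κ × (∀ α → α ∈ κ → ¬ (κ ≼ α))

RegularCardinal : V → Set₁
RegularCardinal θ =
    Cardinal θ
  × ω ⊆ θ
  × (∀ α f → α ∈ θ → Maps f α θ →
       ∃[ β ] (β ∈ θ × (∀ ξ η → App f ξ η → η ∈ β)))

CardinalSuccessor : V → V → Set₁
CardinalSuccessor κ κ⁺ =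
    Cardinal κ⁺
  × κ ∈ κ⁺
  × (∀ μ → Cardinal μ → κ ∈ μ → κ⁺ ⊆ μ)

Isω₂ : V → Set₁
Isω₂ ω₂ = ∃[ ω₁ ] (CardinalSuccessor ω ω₁ × CardinalSuccessor ω₁ ω₂)

-- H = H(θ), the set of all x with ∣trcl x∣ < θ
IsH : V → V → Set₁
IsH θ H = ∀ x → x ∈ H ⇔ (∃[ α ] (α ∈ θ × trcl x ≼ α))

-- First-order formulas of set theory with free variables in Fin n.
data Formula : ℕ → Set where
  mem eq : ∀ {n} → Fin n → Fin n → Formula n
  not    : ∀ {n} → Formula n → Formula n
  and    : ∀ {n} → Formula n → Formula n → Formula n
  forAll : ∀ {n} → Formula (suc n) → Formula n

-- Satisfaction in the structure (A , ∈).
Sat : V → ∀ {n} → Formula n → Vector V n → Set₁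
Sat A (mem i j)  ρ = ρ i ∈ ρ j
Sat A (eq i j)   ρ = ρ i ≈ ρ j
Sat A (not φ)    ρ = ¬ Sat A φ ρ
Sat A (and φ ψ)  ρ = Sat A φ ρ × Sat A ψ ρ
Sat A (forAll φ) ρ = ∀ x → x ∈ A → Sat A φ (x ∷ ρ)

-- M is an elementary submodel of N.
_≺_ : V → V → Set₁
M ≺ N = M ⊆ N ×
  (∀ {n} (φ : Formula n) (ρ : Vector V n) → (∀ i → ρ i ∈ M) →
     Sat M φ ρ ⇔ Sat N φ ρ)

-- M ∈ [A]^ℵ₀
_∈[_]^ℵ₀ : V → V → Set₁
M ∈[ A ]^ℵ₀ = M ⊆ A × M ≼ ω × ω ≼ M

Club : V → V → Set₁
Club A C =
    (∀ M → M ∈ C → M ∈[ A ]^ℵ₀)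
  × (∀ M → M ∈[ A ]^ℵ₀ → ∃[ N ] (N ∈ C × M ⊆ N))
  × (∀ (M : ℕ → V) → (∀ n → M n ∈ C) → (∀ n → M n ⊆ M (suc n)) →
       ⋃ (sup ℕ M) ∈ C)

-- { M ∈ [A]^ℵ₀ : S M } is stationary in [A]^ℵ₀.
Stationary : V → (V → Set₁) → Set₁
Stationary A S = ∀ C → Club A C → ∃[ M ] (M ∈ C × S M)

-- Posets in the sense of forcing: antisymmetry is not required.
Poset : V → V → Set₁
Poset P R =
    R ⊆ (P ×ᵛ P)
  × (∀ p → p ∈ P → ⟪ p , p ⟫ ∈ R)
  × (∀ p q r → ⟪ p , q ⟫ ∈ R → ⟪ q , r ⟫ ∈ R → ⟪ p , r ⟫ ∈ R)

module Forcing (P R : V) where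

  Cond : Set
  Cond = Index P

  _≤_ : Cond → Cond → Set₁
  p ≤ q = ⟪ P ! p , P ! q ⟫ ∈ R

  Compatible : Cond → Cond → Set₁
  Compatible p q = ∃[ r ] (r ≤ p × r ≤ q)

  Residue : V → Cond → Cond → Set₁
  Residue M q q̄ =
    (P ! q̄) ∈ M × (∀ s → s ≤ q̄ → (P ! s) ∈ M → Compatible s q)

  StronglyGeneric : V → Cond → Set₁
  StronglyGeneric M p = ∀ q → q ≤ p → ∃[ q̄ ] Residue M q q̄

  StronglyProperFor : V → Set₁
  StronglyProperFor M =
    ∀ s → (P ! s) ∈ M → ∃[ p ] (p ≤ s × StronglyGeneric M p)

  -- The P-names: name I x s stands for { ⟨x i , s i⟩ : i ∈ I }.
  data Name : Set₁ where
    name : (I : Set) → (I → Name) → (I → Cond) → Name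

  -- The set that a name is.
  code : Name → V
  code (name I x s) = sup I λ i → ⟪ code (x i) , P ! s i ⟫

  -- x̌ = { ⟨y̌ , p⟩ : y ∈ x , p ∈ P }; no largest condition is assumed.
  check : V → Name
  check (sup I f) = name (I × Cond) (λ { (i , _) → check (f i) }) proj₂

  DenselyBelow : Cond → (Cond → Set₁) → Set₁
  DenselyBelow p φ = ∀ q → q ≤ p → ∃[ r ] (r ≤ q × φ r)

  -- (a ≐ᶠ b) p: whenever q ≤ p and ⟨x , s⟩ ∈ a with q ≤ s, q forces x ∈ b
  -- (as in _∈ᶠ_), and symmetrically.
  _≐ᶠ_ : Name → Name → Cond → Set₁
  (name I x s ≐ᶠ name J y t) p =
      (∀ i q → q ≤ p → q ≤ s i →
         DenselyBelow q λ r → ∃[ j ] (r ≤ t j × (x i ≐ᶠ y j) r))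
    × (∀ j q → q ≤ p → q ≤ t j →
         DenselyBelow q λ r → ∃[ i ] (r ≤ s i × (x i ≐ᶠ y j) r))

  _∈ᶠ_ : Name → Name → Cond → Set₁
  (a ∈ᶠ name J y t) p =
    DenselyBelow p λ r → ∃[ j ] (r ≤ t j × (a ≐ᶠ y j) r)

  forcing : Interpretation
  forcing = record
    { Dom    = Name
    ; Ω      = Cond → Set₁
    ; _∈_    = _∈ᶠ_
    ; _≐_    = _≐ᶠ_
    ; falsum = λ p → Lift (lsuc 0ℓ) ⊥
    ; _∧_    = λ φ ψ p → φ p × ψ p
    ; _∨_    = λ φ ψ p → DenselyBelow p λ r → φ r ⊎ ψ r
    ; _⇒_    = λ φ ψ p → ∀ q → q ≤ p → φ q → ψ q
    ; all    = λ φ p → ∀ x → φ x p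
    ; some   = λ φ p → DenselyBelow p λ r → ∃[ x ] φ x r
    }

  module ⊩ = Language forcing

  infix 2 _⊩_
  _⊩_ : Cond → (Cond → Set₁) → Set₁
  p ⊩ φ = φ p

  checkNames : V → V
  checkNames a = sup (Index a) λ i → code (check (a ! i))

  -- The P-names all of whose members are pairs ⟨ẋ , p⟩ with ẋ ∈ N.
  namesOver : V → V
  namesOver N = 𝒫 (N ×ᵛ P)

  -- θ ≥ ω₂, and H = H(θ) contains the power sets of P and X, the families of
  -- subsets of X (hence topologies and open covers), and the names for
  -- subsets of X and for families of such subsets.
  LargeEnough : V → V → V → Set₁
  LargeEnough θ H X =
      (∃[ ω₂ ] (Isω₂ ω₂ × ω₂ ⊆ θ))
    × 𝒫 P ∈ H
    × 𝒫 (𝒫 X) ∈ H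
    × namesOver (namesOver (checkNames X)) ∈ H

{-# OPTIONS --safe #-}
module Submission where

-- Strong properness plays no role: every forcing preserves the existence of a
-- winning strategy σ for II.  In V, after any partial play t there is a point
-- x all of whose open neighbourhoods are of the form σ(t⌢𝒰), since otherwise
-- the open sets not of this form would be a cover refuting σ.  In V[G], II
-- carries along a play t in V: facing a cover 𝒱, take such an x, some v ∈ 𝒱
-- containing x and an open U ∈ V with x ∈ U ⊆ v; then U = σ(t⌢𝒰) for some
-- 𝒰 ∈ V, and II answers v and passes to t⌢𝒰 (v and 𝒰 being chosen by means
-- of a well-ordering in V).  For each x ∈ X the tree of plays in V whose
-- answers miss x is well-founded because σ is winning, and well-foundedness
-- is absolute: an induction on this tree shows that x gets covered in V[G].

-- The answer of II in V[G] has to be a function of the covers played, so the ground play carried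
-- along must be recoverable from them: this is what least moves are for. There is no generic filter
-- here, only conditions, and a condition need not decide which move is least. Below a given
-- condition one takes the least move that some stronger condition forces to be acceptable; below
-- that stronger condition nothing lower can ever become acceptable. Runs of least moves therefore
-- exist densely, while their uniqueness holds below every condition. For a well-ordering in V to
-- apply, the moves must form a set of V. Open sets of V[G] are therefore represented by nice names,
-- Boolean functions on `Index X × Cond`, and compared through their codes. As equality of sets is
-- `≈` and not identity, uniqueness is always meant up to this relation. Absoluteness of
-- well-foundedness is not invoked as a theorem: the tree is an inductive family, and recursion on
-- it goes through while conditions get stronger.

open import Defs
open import Level using (Lift; 0ℓ; lift; lower) renaming (suc to lsuc)
open import Axiom.ExcludedMiddle using (ExcludedMiddle)
open import Data.Bool using (Bool; true; false; T)
open import Data.Empty using (⊥; ⊥-elim)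
open import Data.List using (List; []; _∷_; length; map)
open import Data.List.Relation.Binary.Pointwise as Pointwise
  using (Pointwise; []; _∷_; symmetric; Pointwise-length; map⁺)
open import Data.Nat using (ℕ; zero; suc; _<_; s≤s)
open import Data.Nat.Properties
  using (<-cmp; <-irrefl; m≤n⇒m<n∨m≡n; m≤n⇒m≤1+n; ≤-refl; suc-injective)
open import Data.Product using (Σ; Σ-syntax; ∃; ∃-syntax; _×_; _,_; proj₁; proj₂)
open import Data.Sum as Sum using (_⊎_; inj₁; inj₂; [_,_]′)
open import Function using (_∘_)
open import Relation.Binary.Definitions using (tri<; tri≈; tri>)
open import Relation.Binary.PropositionalEquality using (_≡_; refl; sym; cong; subst)
open import Relation.Nullary using (¬_; yes; no)
open import Relation.Nullary.Decidable using (⌊_⌋; toWitness; fromWitness)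

-- Wrappers: _≈_ and _∈_ compute, so that their arguments cannot be inferred.

infix 4 _≋_ _∊_

record _≋_ (a b : V) : Set₁ where
  constructor mk≋
  field un≋ : a ≈ b
open _≋_

record _∊_ (a b : V) : Set₁ where
  constructor mk∊
  field un∊ : a ∈ b
open _∊_

-- Extensional equality, ordered pairs and numerals in `V`.

≈-refl : ∀ a → a ≈ a
≈-refl (sup I f) = (λ i → i , ≈-refl (f i)) , (λ i → i , ≈-refl (f i))

≈-sym : ∀ a b → a ≈ b → b ≈ a
≈-sym (sup I f) (sup J g) (l , r) =
    (λ j → let i , e = r j in i , ≈-sym (f i) (g j) e)
  , (λ i → let j , e = l i in j , ≈-sym (f i) (g j) e)

≈-trans : ∀ a b c → a ≈ b → b ≈ c → a ≈ c
≈-trans (sup I f) (sup J g) (sup K h) (l , r) (l′ , r′) =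
    (λ i → let j , e = l i ; k , e′ = l′ j in k , ≈-trans (f i) (g j) (h k) e e′)
  , (λ k → let j , e′ = r′ k ; i , e = r j in i , ≈-trans (f i) (g j) (h k) e e′)

≋-refl : ∀ {a} → a ≋ a
≋-refl = mk≋ (≈-refl _)

≋-sym : ∀ {a b} → a ≋ b → b ≋ a
≋-sym (mk≋ e) = mk≋ (≈-sym _ _ e)

≋-trans : ∀ {a b c} → a ≋ b → b ≋ c → a ≋ c
≋-trans (mk≋ e) (mk≋ e′) = mk≋ (≈-trans _ _ _ e e′)

≡⇒≋ : ∀ {a b} → a ≡ b → a ≋ b
≡⇒≋ refl = ≋-refl

∊-intro : ∀ {x} a i → x ≋ a ! i → x ∊ a
∊-intro a i (mk≋ e) = mk∊ (i , e)

∊-elim : ∀ {x a} → x ∊ a → ∃[ i ] (x ≋ a ! i)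
∊-elim (mk∊ (i , e)) = i , mk≋ e

!-∊ : ∀ a i → a ! i ∊ a
!-∊ a i = ∊-intro a i ≋-refl

∊-respˡ : ∀ {x y a} → x ≋ y → x ∊ a → y ∊ a
∊-respˡ e x∊a = let i , e′ = ∊-elim x∊a in ∊-intro _ i (≋-trans (≋-sym e) e′)

∊-respʳ : ∀ {x a b} → a ≋ b → x ∊ a → x ∊ b
∊-respʳ {a = sup I f} {sup J g} (mk≋ (l , _)) x∊a =
  let i , e = ∊-elim x∊a ; j , e′ = l i in ∊-intro (sup J g) j (≋-trans e (mk≋ e′))

≋-ext : ∀ {a b} → (∀ {x} → x ∊ a → x ∊ b) → (∀ {x} → x ∊ b → x ∊ a) → a ≋ b
≋-ext {sup I f} {sup J g} l r = mk≋
  ( (λ i → un∊ (l (!-∊ (sup I f) i)))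
  , (λ j → let i , e = ∊-elim (r (!-∊ (sup J g) j)) in i , un≋ (≋-sym e)))

∊-irrefl : ∀ a → ¬ a ∊ a
∊-irrefl (sup I f) a∊a =
  let i , e = ∊-elim a∊a in ∊-irrefl (f i) (∊-respˡ e (∊-respʳ e a∊a))

∊-pairˡ : ∀ {x a b} → x ≋ a → x ∊ ⁅ a , b ⁆
∊-pairˡ = ∊-intro ⁅ _ , _ ⁆ true

∊-pairʳ : ∀ {x a b} → x ≋ b → x ∊ ⁅ a , b ⁆
∊-pairʳ = ∊-intro ⁅ _ , _ ⁆ false

∊-pair⁻ : ∀ {x a b} → x ∊ ⁅ a , b ⁆ → x ≋ a ⊎ x ≋ b
∊-pair⁻ x∊ with ∊-elim x∊
... | true  , e = inj₁ e
... | false , e = inj₂ e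

∊-single⁻ : ∀ {x a} → x ∊ ⁅ a , a ⁆ → x ≋ a
∊-single⁻ x∊ = [ (λ e → e) , (λ e → e) ]′ (∊-pair⁻ x∊)

⁅⁆-cong : ∀ {a b c d} → a ≋ c → b ≋ d → ⁅ a , b ⁆ ≋ ⁅ c , d ⁆
⁅⁆-cong e e′ = ≋-ext
  (λ x∊ → [ (λ h → ∊-pairˡ (≋-trans h e)) , (λ h → ∊-pairʳ (≋-trans h e′)) ]′ (∊-pair⁻ x∊))
  (λ x∊ → [ (λ h → ∊-pairˡ (≋-trans h (≋-sym e))) , (λ h → ∊-pairʳ (≋-trans h (≋-sym e′))) ]′
            (∊-pair⁻ x∊))

⟪⟫-cong : ∀ {a b c d} → a ≋ c → b ≋ d → ⟪ a , b ⟫ ≋ ⟪ c , d ⟫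
⟪⟫-cong e e′ = ⁅⁆-cong (⁅⁆-cong e e) (⁅⁆-cong e e′)

⟪⟫-injˡ : ∀ {a b c d} → ⟪ a , b ⟫ ≋ ⟪ c , d ⟫ → a ≋ c
⟪⟫-injˡ e with ∊-pair⁻ (∊-respʳ e (∊-pairˡ ≋-refl))
... | inj₁ h = ≋-sym (∊-single⁻ (∊-respʳ (≋-sym h) (∊-pairˡ ≋-refl)))
... | inj₂ h = ≋-sym (∊-single⁻ (∊-respʳ (≋-sym h) (∊-pairˡ ≋-refl)))

⟪⟫-injʳ : ∀ {a b c d} → ⟪ a , b ⟫ ≋ ⟪ c , d ⟫ → b ≋ d
⟪⟫-injʳ {a} {b} {c} {d} e =
  [ fromSecond ∊-single⁻ , fromSecond′ ]′ (∊-pair⁻ (∊-respʳ (≋-sym e) (∊-pairʳ ≋-refl)))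
  where
  a≋c = ⟪⟫-injˡ e
  b≋c⊎b≋d : b ≋ c ⊎ b ≋ d
  b≋c⊎b≋d = [ (λ h → inj₁ (∊-single⁻ (∊-respʳ h (∊-pairʳ ≋-refl))))
            , (λ h → ∊-pair⁻ (∊-respʳ h (∊-pairʳ ≋-refl))) ]′
            (∊-pair⁻ (∊-respʳ e (∊-pairʳ ≋-refl)))
  d≋a⇒b≋d : d ≋ a → b ≋ d
  d≋a⇒b≋d d≋a = [ (λ h → ≋-trans h (≋-trans (≋-sym a≋c) (≋-sym d≋a))) , (λ h → h) ]′ b≋c⊎b≋d
  fromSecond : ∀ {w} → (d ∊ w → d ≋ a) → ⁅ c , d ⁆ ≋ w → b ≋ d
  fromSecond k h = d≋a⇒b≋d (k (∊-respʳ h (∊-pairʳ ≋-refl)))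
  fromSecond′ : ⁅ c , d ⁆ ≋ ⁅ a , b ⁆ → b ≋ d
  fromSecond′ h = [ d≋a⇒b≋d , ≋-sym ]′ (∊-pair⁻ (∊-respʳ h (∊-pairʳ ≋-refl)))

succ : V → V
succ n = ⋃ ⁅ n , ⁅ n , n ⁆ ⁆

∊-succˡ : ∀ {x n} → x ∊ n → x ∊ succ n
∊-succˡ {n = n} x∊n = let i , e = ∊-elim x∊n in ∊-intro (succ n) (true , i) e

∊-succʳ : ∀ {x n} → x ≋ n → x ∊ succ n
∊-succʳ {n = n} = ∊-intro (succ n) (false , true)

∊-succ⁻ : ∀ {x n} → x ∊ succ n → x ∊ n ⊎ x ≋ n
∊-succ⁻ {n = n} x∊ with ∊-elim x∊
... | (true  , i)     , e = inj₁ (∊-intro n i e)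
... | (false , true)  , e = inj₂ e
... | (false , false) , e = inj₂ e

∊-∅ : ∀ {x} → ¬ x ∊ ∅
∊-∅ x∊ with ∊-elim x∊
... | () , _

numeral-< : ∀ {m n} → m < n → numeral m ∊ numeral n
numeral-< {m} {suc n} (s≤s m≤n) with m≤n⇒m<n∨m≡n m≤n
... | inj₁ m<n  = ∊-succˡ (numeral-< m<n)
... | inj₂ refl = ∊-succʳ ≋-refl

∊-numeral⁻ : ∀ {x} n → x ∊ numeral n → ∃[ k ] (k < n × x ≋ numeral k)
∊-numeral⁻ zero    x∊ = ⊥-elim (∊-∅ x∊)
∊-numeral⁻ (suc n) x∊ with ∊-succ⁻ x∊
... | inj₁ x∊n = let k , k<n , e = ∊-numeral⁻ n x∊n in k , m≤n⇒m≤1+n k<n , e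
... | inj₂ x≋n = n , ≤-refl , x≋n

numeral-injective : ∀ {m n} → numeral m ≋ numeral n → m ≡ n
numeral-injective {m} {n} e with <-cmp m n
... | tri≈ _ m≡n _ = m≡n
... | tri< m<n _ _ = ⊥-elim (∊-irrefl _ (∊-respʳ (≋-sym e) (numeral-< m<n)))
... | tri> _ _ n<m = ⊥-elim (∊-irrefl _ (∊-respʳ e (numeral-< n<m)))

-- Formulas over `V` translated into statements about concrete sets.

module 𝕃 = Language 𝕍

UPair⇒ : ∀ {z a b} → 𝕃.UPair z a b → z ≋ ⁅ a , b ⁆
UPair⇒ h = ≋-ext
  (λ { {x} (mk∊ x∊) → [ (λ e → ∊-pairˡ (mk≋ e)) , (λ e → ∊-pairʳ (mk≋ e)) ]′ (proj₁ (h x) x∊) })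
  (λ {x} x∊ → mk∊ (proj₂ (h x) ([ (λ e → inj₁ (un≋ e)) , (λ e → inj₂ (un≋ e)) ]′ (∊-pair⁻ x∊))))

⇒UPair : ∀ {z a b} → z ≋ ⁅ a , b ⁆ → 𝕃.UPair z a b
⇒UPair e x =
    (λ x∊ → [ (λ h → inj₁ (un≋ h)) , (λ h → inj₂ (un≋ h)) ]′ (∊-pair⁻ (∊-respʳ e (mk∊ x∊))))
  , (λ h → un∊ (∊-respʳ (≋-sym e) ([ (λ k → ∊-pairˡ (mk≋ k)) , (λ k → ∊-pairʳ (mk≋ k)) ]′ h)))

OPair⇒ : ∀ {z a b} → 𝕃.OPair z a b → z ≋ ⟪ a , b ⟫
OPair⇒ (u , v , hu , hv , hz) = ≋-trans (UPair⇒ hz) (⁅⁆-cong (UPair⇒ hu) (UPair⇒ hv))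

⇒OPair : ∀ {z a b} → z ≋ ⟪ a , b ⟫ → 𝕃.OPair z a b
⇒OPair e = _ , _ , ⇒UPair ≋-refl , ⇒UPair ≋-refl , ⇒UPair e

App⇒ : ∀ {f x y} → App f x y → ⟪ x , y ⟫ ∊ f
App⇒ (z , z∊f , hz) = ∊-respˡ (OPair⇒ hz) (mk∊ z∊f)

⇒App : ∀ {f x y} → ⟪ x , y ⟫ ∊ f → App f x y
⇒App h = _ , un∊ h , ⇒OPair ≋-refl

⇒Succ : ∀ {n m} → m ≋ succ n → 𝕃.Succ n m
⇒Succ e x =
    (λ x∊ → [ (λ h → inj₁ (un∊ h)) , (λ h → inj₂ (un≋ h)) ]′ (∊-succ⁻ (∊-respʳ e (mk∊ x∊))))
  , (λ h → un∊ (∊-respʳ (≋-sym e) ([ (λ k → ∊-succˡ (mk∊ k)) , (λ k → ∊-succʳ (mk≋ k)) ]′ h)))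

Succ⇒ : ∀ {n m} → 𝕃.Succ n m → m ≋ succ n
Succ⇒ h = ≋-ext
  (λ { {x} (mk∊ x∊) → [ (λ e → ∊-succˡ (mk∊ e)) , (λ e → ∊-succʳ (mk≋ e)) ]′ (proj₁ (h x) x∊) })
  (λ {x} x∊ → mk∊ (proj₂ (h x) ([ (λ e → inj₁ (un∊ e)) , (λ e → inj₂ (un≋ e)) ]′ (∊-succ⁻ x∊))))

succ-cong : ∀ {m n} → m ≋ n → succ m ≋ succ n
succ-cong e = ≋-ext
  (λ x∊ → [ (λ h → ∊-succˡ (∊-respʳ e h)) , (λ h → ∊-succʳ (≋-trans h e)) ]′ (∊-succ⁻ x∊))
  (λ x∊ → [ (λ h → ∊-succˡ (∊-respʳ (≋-sym e) h)) , (λ h → ∊-succʳ (≋-trans h (≋-sym e))) ]′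
            (∊-succ⁻ x∊))

Omega⇒ω : ∀ {w} → 𝕃.Omega w → w ≋ ω
Omega⇒ω {w} ((( e , e∈w , e-empty) , step) , least) = ≋-ext
  (λ x∊w → mk∊ (least ω ω-inductive _ (un∊ x∊w)))
  (λ x∊ω → let n , x≋n = ∊-elim x∊ω in ∊-respˡ (≋-sym x≋n) (numeral∊w n))
  where
  ω-inductive : 𝕃.Inductive ω
  ω-inductive = (∅ , un∊ (!-∊ ω zero) , λ x x∈ → lift (∊-∅ (mk∊ x∈)))
    , λ n n∈ω → let k , n≋k = ∊-elim (mk∊ n∈ω) in
        numeral (suc k) , un∊ (!-∊ ω (suc k)) , ⇒Succ (succ-cong (≋-sym n≋k))
  numeral∊w : ∀ n → numeral n ∊ w
  numeral∊w zero = ∊-respˡ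
    (≋-ext (λ x∊e → ⊥-elim (lower (e-empty _ (un∊ x∊e)))) (λ x∊∅ → ⊥-elim (∊-∅ x∊∅)))
    (mk∊ e∈w)
  numeral∊w (suc n) =
    let m , m∈w , hm = step _ (un∊ (numeral∊w n)) in ∊-respˡ (Succ⇒ hm) (mk∊ m∈w)

-- Positions are counted from the end of the list. The latest move stands first, so the number of a
-- round does not shift when the play is prolonged.
data At {A : Set} : List A → ℕ → A → Set where
  here  : ∀ {m t} → At (m ∷ t) (length t) m
  there : ∀ {m m′ t k} → At t k m → At (m′ ∷ t) k m

At⇒< : ∀ {A : Set} {t k} {m : A} → At t k m → k < length t
At⇒< here      = ≤-refl
At⇒< (there h) = m≤n⇒m≤1+n (At⇒< h)

<⇒At : ∀ {A : Set} (t : List A) {k} → k < length t → ∃[ m ] At t k m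
<⇒At (m ∷ t) (s≤s k≤) with m≤n⇒m<n∨m≡n k≤
... | inj₁ k<   = let m′ , h = <⇒At t k< in m′ , there h
... | inj₂ refl = m , here

At-functional : ∀ {A : Set} {t k} {m m′ : A} → At t k m → At t k m′ → m ≡ m′
At-functional here      here       = refl
At-functional here      (there h)  = ⊥-elim (<-irrefl refl (At⇒< h))
At-functional (there h) here       = ⊥-elim (<-irrefl refl (At⇒< h))
At-functional (there h) (there h′) = At-functional h h′

module Decide (em : ExcludedMiddle (lsuc 0ℓ)) where

  -- Resizing by excluded middle: a collection cut out by a `Set₁` predicate stays in `Set`, so that
  -- it may index a set of `V` or a name.
  decide : Set₁ → Bool
  decide A = ⌊ em {A} ⌋

  decide⁺ : ∀ {A} → A → T (decide A)
  decide⁺ = fromWitness {a? = em}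

  decide⁻ : ∀ {A} → T (decide A) → A
  decide⁻ = toWitness {a? = em}

  dne : {A : Set₁} → ¬ ¬ A → A
  dne {A} ¬¬a with em {A}
  ... | yes a = a
  ... | no ¬a = ⊥-elim (¬¬a ¬a)

  ¬∀⇒∃¬ : {A : Set} {B : A → Set₁} → ¬ (∀ a → B a) → ∃[ a ] ¬ B a
  ¬∀⇒∃¬ {A} {B} ¬∀ with em {∃[ a ] ¬ B a}
  ... | yes h = h
  ... | no ¬h = ⊥-elim (¬∀ λ a → dne λ ¬b → ¬h (a , ¬b))

-- Zermelo's theorem for the set { f i : i ∈ I }: the stages are generated
-- by unions and by adding a chosen element of the complement; i ◁ j when
-- some stage contains i but not j.

module WellOrder (em : ExcludedMiddle (lsuc 0ℓ)) (ac : AxiomOfChoice)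
                 (I : Set) (f : I → V) where
  open Decide em

  Subset : Set
  Subset = I → Bool

  infix 4 _∈ˢ_ _⊑_ _◁_

  record _∈ˢ_ (i : I) (S : Subset) : Set₁ where
    constructor mk∈ˢ
    field un∈ˢ : T (S i)
  open _∈ˢ_

  _⊑_ : Subset → Subset → Set₁
  S ⊑ S′ = ∀ i → i ∈ˢ S → i ∈ˢ S′

  ⊑-split : ∀ S S′ → S ⊑ S′ ⊎ (∃[ i ] (i ∈ˢ S × ¬ i ∈ˢ S′))
  ⊑-split S S′ with em {∃[ i ] (i ∈ˢ S × ¬ i ∈ˢ S′)}
  ... | yes h = inj₂ h
  ... | no ¬h = inj₁ λ i i∈S → dne λ i∉S′ → ¬h (i , i∈S , i∉S′)

  complement : Subset → V
  complement S = sup (Σ[ i ∈ I ] ¬ T (S i)) λ { (i , _) → f i }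

  Proper : Subset → Set₁
  Proper S = ∃[ i ] ¬ i ∈ˢ S

  complements : V
  complements = sup (Σ[ S ∈ Subset ] T (decide (Proper S))) λ { (S , _) → complement S }

  choice : ∃[ c ] (Function c complements × (∀ x y → x ∈ complements → App c x y → y ∈ x))
  choice = ac complements λ x x∈ →
    let (S , h) , e = ∊-elim (mk∊ x∈) ; i , i∉S = decide⁻ h in
    f i , un∊ (∊-respʳ (≋-sym e) (∊-intro (complement S) (i , λ h → i∉S (mk∈ˢ h)) ≋-refl))

  complement∊ : ∀ {S} → Proper S → complement S ∊ complements
  complement∊ {S} p = ∊-intro complements (S , decide⁺ p) ≋-refl

  chosen : ∀ {S} → Proper S → ∃[ y ] (⟪ complement S , y ⟫ ∊ proj₁ choice)
  chosen {S} p =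
    let y , h = proj₁ (proj₂ (proj₁ (proj₂ choice))) (complement S) (un∊ (complement∊ p))
    in y , App⇒ h

  pick : ∀ {S} (p : Proper S) → ∃[ i ] (¬ i ∈ˢ S × f i ≋ proj₁ (chosen p))
  pick {S} p =
    let y , h = chosen p
        (i , i∉S) , e = ∊-elim {a = complement S}
          (mk∊ (proj₂ (proj₂ choice) (complement S) y (un∊ (complement∊ p)) (⇒App h)))
    in i , (λ h → i∉S (un∈ˢ h)) , ≋-sym e

  -- Subsets with the same members need not be equal as functions, but their complements are `≋`,
  -- and the choice function is a set of pairs in `V`, hence respects `≋`.
  chosen-cong : ∀ {S S′} (p : Proper S) (p′ : Proper S′) → S ⊑ S′ → S′ ⊑ S →
                proj₁ (chosen p) ≋ proj₁ (chosen p′)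
  chosen-cong {S} {S′} p p′ S⊑S′ S′⊑S =
    mk≋ (proj₂ (proj₂ (proj₁ (proj₂ choice))) _ _ _ (⇒App (proj₂ (chosen p)))
          (⇒App (∊-respˡ (⟪⟫-cong (≋-sym same) ≋-refl) (proj₂ (chosen p′)))))
    where
    same : complement S ≋ complement S′
    same = ≋-ext
      (λ x∊ → let (i , i∉) , e = ∊-elim x∊ in
              ∊-intro (complement S′) (i , λ h → i∉ (un∈ˢ (S′⊑S _ (mk∈ˢ h)))) e)
      (λ x∊ → let (i , i∉) , e = ∊-elim x∊ in
              ∊-intro (complement S) (i , λ h → i∉ (un∈ˢ (S⊑S′ _ (mk∈ˢ h)))) e)

  -- All indices carrying the chosen value enter at once, so that no stage ever separates indices
  -- with `≋` values.
  New : Subset → I → Set₁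
  New S i = Σ[ p ∈ Proper S ] (f i ≋ proj₁ (chosen p))

  infix 8 _⁺
  _⁺ : Subset → Subset
  (S ⁺) i = decide (i ∈ˢ S ⊎ New S i)

  ∈⁺ : ∀ {S i} → i ∈ˢ S ⊎ New S i → i ∈ˢ S ⁺
  ∈⁺ h = mk∈ˢ (decide⁺ h)

  ∈⁺⁻ : ∀ {S i} → i ∈ˢ S ⁺ → i ∈ˢ S ⊎ New S i
  ∈⁺⁻ (mk∈ˢ h) = decide⁻ h

  ⋃ˢ : (Subset → Bool) → Subset
  ⋃ˢ F i = decide (∃[ S ] (T (F S) × i ∈ˢ S))

  -- The tower of the Bourbaki-Witt argument, which avoids ordinals. The empty stage is the join of
  -- the empty family. Coding families by `F` into `Bool` permits joins over families that are
  -- themselves defined in terms of `Stage`.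
  data Stage : Subset → Set₁ where
    next : ∀ {S} → Stage S → Stage (S ⁺)
    join : ∀ F → (∀ {S} → T (F S) → Stage S) → Stage (⋃ˢ F)

  New-cong : ∀ {S i j} → f i ≋ f j → New S i → New S j
  New-cong e (p , h) = p , ≋-trans (≋-sym e) h

  New-unique : ∀ {S i j} → New S i → New S j → f i ≋ f j
  New-unique (p , h) (p′ , h′) =
    ≋-trans h (≋-trans (chosen-cong p p′ (λ _ k → k) (λ _ k → k)) (≋-sym h′))

  closed : ∀ {S i j} → Stage S → f i ≋ f j → i ∈ˢ S → j ∈ˢ S
  closed (next st) e i∈ =
    ∈⁺ ([ (λ h → inj₁ (closed st e h)) , (λ h → inj₂ (New-cong e h)) ]′ (∈⁺⁻ i∈))
  closed (join F st) e (mk∈ˢ i∈) =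
    let S , h , i∈S = decide⁻ i∈ in mk∈ˢ (decide⁺ (S , h , closed (st h) e i∈S))

  ⁺-mono : ∀ {S S′} → S ⊑ S′ → S′ ⊑ S → S ⁺ ⊑ S′ ⁺
  ⁺-mono l r _ i∈ = ∈⁺ ([ (λ h → inj₁ (l _ h))
    , (λ { ((i , i∉) , h) → let p′ = i , (λ k → i∉ (r _ k)) in
           inj₂ (p′ , ≋-trans h (chosen-cong (i , i∉) p′ l r)) }) ]′ (∈⁺⁻ i∈))

  Comparable : Subset → Set₁
  Comparable S = ∀ {S′} → Stage S′ → S′ ⊑ S ⊎ S ⊑ S′

  -- No stage lies strictly between `S` and `S ⁺`. The critical case is `S″ ⊑ S ⊑ S″ ⁺`: a member of
  -- `S` outside `S″` has the value added to `S″`, and since `S` is closed under `≋` of values,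
  -- `S″ ⁺ ⊑ S`; if there is no such member, `S` and `S″` coincide and so do their successors.
  successor-comparable : ∀ {S} → Stage S → Comparable S →
                         ∀ {S′} → Stage S′ → S′ ⊑ S ⊎ S ⁺ ⊑ S′
  successor-comparable st cmp (next {S″} st″) with successor-comparable st cmp st″ | cmp (next st″)
  ... | inj₂ S⁺⊑ | _        = inj₂ λ _ h → ∈⁺ (inj₁ (S⁺⊑ _ h))
  ... | inj₁ _   | inj₁ ⊑S  = inj₁ ⊑S
  ... | inj₁ ⊑S  | inj₂ S⊑  with ⊑-split _ S″
  ...   | inj₁ S⊑S″ = inj₂ (⁺-mono S⊑S″ ⊑S)
  ...   | inj₂ (i , i∈S , i∉S″) with ∈⁺⁻ (S⊑ i i∈S)
  ...     | inj₁ i∈S″ = ⊥-elim (i∉S″ i∈S″)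
  ...     | inj₂ new  = inj₁ λ _ h →
    [ ⊑S _ , (λ new′ → closed st (New-unique new new′) i∈S) ]′ (∈⁺⁻ h)
  successor-comparable {S} st cmp (join F sts) with em {∃[ S′ ] (T (F S′) × S ⁺ ⊑ S′)}
  ... | yes (S′ , h , S⁺⊑) = inj₂ λ _ k → mk∈ˢ (decide⁺ (S′ , h , S⁺⊑ _ k))
  ... | no ¬h = inj₁ λ { _ (mk∈ˢ k) → let S′ , h , i∈ = decide⁻ k in
    [ (λ S′⊑S → S′⊑S _ i∈) , (λ S⁺⊑ → ⊥-elim (¬h (S′ , h , S⁺⊑))) ]′
      (successor-comparable st cmp (sts h)) }

  linear : ∀ {S} → Stage S → Comparable S
  linear (next st) st′ with successor-comparable st (linear st) st′
  ... | inj₁ S′⊑S = inj₁ λ _ h → ∈⁺ (inj₁ (S′⊑S _ h))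
  ... | inj₂ S⁺⊑  = inj₂ S⁺⊑
  linear (join F sts) {S′} st′ with em {∃[ S ] (T (F S) × S′ ⊑ S)}
  ... | yes (S , h , S′⊑S) = inj₁ λ _ k → mk∈ˢ (decide⁺ (S , h , S′⊑S _ k))
  ... | no ¬h = inj₂ λ { _ (mk∈ˢ k) → let S , h , i∈ = decide⁻ k in
    [ (λ S′⊑S → ⊥-elim (¬h (S , h , S′⊑S))) , (λ S⊑S′ → S⊑S′ _ i∈) ]′ (linear (sts h) st′) }

  _◁_ : I → I → Set₁
  i ◁ j = ∃[ S ] (Stage S × i ∈ˢ S × ¬ j ∈ˢ S)

  -- Let `U` be the union of all stages avoiding `Q`, itself such a stage. If `U ⁺` avoided `Q` too,
  -- it would be contained in `U`, although it has a member outside `U`.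
  cut : (Q : I → Set₁) → ∃ Q →
        ∃[ S ] (Stage S × (∀ i → i ∈ˢ S → ¬ Q i) × ∃[ j ] (j ∈ˢ S ⁺ × Q j))
  cut Q (q , Qq) = U , U-stage , U-avoids , dne ¬¬meets
    where
    Avoids : Subset → Set₁
    Avoids S = ∀ i → i ∈ˢ S → ¬ Q i
    F : Subset → Bool
    F S = decide (Stage S × Avoids S)
    U = ⋃ˢ F
    U-stage : Stage U
    U-stage = join F λ h → proj₁ (decide⁻ h)
    U-avoids : Avoids U
    U-avoids _ (mk∈ˢ k) = let S , h , i∈ = decide⁻ k in proj₂ (decide⁻ h) _ i∈
    U-proper : Proper U
    U-proper = q , λ q∈U → U-avoids q q∈U Qq
    ¬¬meets : ¬ ¬ (∃[ j ] (j ∈ˢ U ⁺ × Q j))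
    ¬¬meets none =
      let i , i∉U , e = pick U-proper
      in i∉U (mk∈ˢ (decide⁺ (U ⁺ , decide⁺ (next U-stage , λ j h Qj → none (j , h , Qj))
                                 , ∈⁺ (inj₂ (U-proper , e)))))

  -- Take `j` in `U ⁺` satisfying `Q`. A stage that omits `j` cannot include `U ⁺`, so it is part of
  -- `U` and avoids `Q`.
  ◁-minimal : (Q : I → Set₁) → ∃ Q → ∃[ j ] (Q j × (∀ i → i ◁ j → ¬ Q i))
  ◁-minimal Q ∃Q =
    let U , U-stage , U-avoids , j , j∈U⁺ , Qj = cut Q ∃Q in
    j , Qj , λ { i (S , st , i∈S , j∉S) →
      [ (λ S⊑U → U-avoids i (S⊑U _ i∈S)) , (λ U⁺⊑S → ⊥-elim (j∉S (U⁺⊑S _ j∈U⁺))) ]′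
        (successor-comparable U-stage (linear U-stage) st) }

  -- Cut at the single index `i`, which is then new in `U ⁺`. If `j` were missing from `U ⁺`, then
  -- `i ◁ j`; if it were already in `U`, then `j ◁ i`. So both are new at the same stage, and only
  -- one value is added there.
  ◁-connected : ∀ i j → ¬ i ◁ j → ¬ j ◁ i → f i ≋ f j
  ◁-connected i j ¬i◁j ¬j◁i =
    let U , U-stage , U-avoids , k , k∈U⁺ , lift k≡i =
          cut (λ k → Lift (lsuc 0ℓ) (k ≡ i)) (i , lift refl)
        i∉U  = λ i∈U → U-avoids i i∈U (lift refl)
        i∈U⁺ = subst (_∈ˢ U ⁺) k≡i k∈U⁺
        j∈U⁺ = dne λ j∉U⁺ → ¬i◁j (U ⁺ , next U-stage , i∈U⁺ , j∉U⁺)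
        j∉U  = λ j∈U → ¬j◁i (U , U-stage , j∈U , i∉U)
    in New-unique (new i∉U i∈U⁺) (new j∉U j∈U⁺)
    where
    new : ∀ {S k} → ¬ k ∈ˢ S → k ∈ˢ S ⁺ → New S k
    new k∉S k∈S⁺ = [ (λ k∈S → ⊥-elim (k∉S k∈S)) , (λ h → h) ]′ (∈⁺⁻ k∈S⁺)

-- The game in the ground model.

module VStrategy (em : ExcludedMiddle (lsuc 0ℓ)) (X τ : V) (win : IIWinsRothberger X τ) where
  open Decide em

  -- Covers are coded by Boolean functions in order to be a `Set`: they will be components of moves,
  -- which have to be well-ordered in `V`.
  Cover : Set
  Cover = Σ[ χ ∈ (Index τ → Bool) ] T (decide (𝕃.OpenCover X τ (𝒫 τ ! χ)))

  cover : Cover → V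
  cover (χ , _) = 𝒫 τ ! χ

  cover-open : ∀ c → 𝕃.OpenCover X τ (cover c)
  cover-open (χ , h) = decide⁻ h

  -- A list of covers is a partial play with the latest move first.
  seq : List Cover → V
  seq t = sup (∃[ k ] ∃[ c ] At t k c) λ { (k , c , _) → ⟪ numeral k , cover c ⟫ }

  seq⁺ : ∀ {t k c} → At t k c → ⟪ numeral k , cover c ⟫ ∊ seq t
  seq⁺ {t} h = ∊-intro (seq t) (_ , _ , h) ≋-refl

  -- Serves both finite plays, where `K` consists of the occurrences in a list, and infinite runs,
  -- where `K` is `ℕ`.
  CoverSequenceFrom : ∀ {s d} (K : Set) (x : K → ℕ) (c : K → Cover) →
    (∀ {k k′} → x k ≡ x k′ → c k ≡ c k′) →
    s ≋ sup K (λ k → ⟪ numeral (x k) , cover (c k) ⟫) →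
    (∀ k → numeral (x k) ∊ d) → (∀ {y} → y ∊ d → ∃[ k ] (y ≋ numeral (x k))) →
    𝕃.CoverSequence X τ s d
  CoverSequenceFrom {s} {d} K x c functional e total⁻ total =
    ( (λ z z∈ → let k , e′ = entry (mk∊ z∈) in
         _ , un∊ (total⁻ k) , _ , ⇒OPair e′)
    , (λ y y∈ → let k , e′ = total (mk∊ y∈) in
         cover (c k) , ⇒App (∊-respʳ (≋-sym e)
           (∊-intro (sup K λ k → ⟪ numeral (x k) , cover (c k) ⟫) k (⟪⟫-cong e′ ≋-refl))))
    , (λ i y y′ h h′ →
         let k , p = entry (App⇒ h) ; k′ , p′ = entry (App⇒ h′)
             same = functional (numeral-injective (≋-trans (≋-sym (⟪⟫-injˡ p)) (⟪⟫-injˡ p′)))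
         in un≋ (≋-trans (⟪⟫-injʳ p) (≋-trans (≡⇒≋ (cong cover same)) (≋-sym (⟪⟫-injʳ p′))))) )
    , λ i 𝒰 h → let k , p = entry (App⇒ h) in OpenCover-resp (≋-sym (⟪⟫-injʳ p)) (cover-open (c k))
    where
    entry : ∀ {z} → z ∊ s → ∃[ k ] (z ≋ ⟪ numeral (x k) , cover (c k) ⟫)
    entry z∊ = ∊-elim (∊-respʳ e z∊)
    OpenCover-resp : ∀ {𝒰 𝒱} → 𝒰 ≋ 𝒱 → 𝕃.OpenCover X τ 𝒰 → 𝕃.OpenCover X τ 𝒱
    OpenCover-resp e (sub , cov) =
        (λ u u∈ → sub u (un∊ (∊-respʳ (≋-sym e) (mk∊ u∈))))
      , (λ y y∈ → let u , u∈ , h = cov y y∈ in u , un∊ (∊-respʳ e (mk∊ u∈)) , h)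

  seq-CoverSequence : ∀ t → 𝕃.CoverSequence X τ (seq t) (numeral (length t))
  seq-CoverSequence t = CoverSequenceFrom _ proj₁ (λ { (_ , c , _) → c })
    (λ { {_ , _ , h} {_ , _ , h′} refl → At-functional h h′ }) ≋-refl
    (λ { (_ , _ , h) → numeral-< (At⇒< h) })
    (λ y∊ → let k , k< , e = ∊-numeral⁻ _ y∊ ; c , h = <⇒At t k< in (k , c , h) , e)

  private
    w σ : V
    w = proj₁ win
    σ = proj₁ (proj₂ (proj₂ win))

    w≋ω : w ≋ ω
    w≋ω = Omega⇒ω (proj₁ (proj₂ win))

    strategy : 𝕃.Strategy X τ w σ
    strategy = proj₁ (proj₂ (proj₂ (proj₂ win)))

    winning : 𝕃.Winning X τ w σ
    winning = proj₂ (proj₂ (proj₂ (proj₂ win)))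

    numeral∊w : ∀ k → numeral k ∊ w
    numeral∊w k = ∊-respʳ (≋-sym w≋ω) (!-∊ ω k)

    σ-functional : ∀ {s s′ u u′} → s ≋ s′ → App σ s u → App σ s′ u′ → u ≋ u′
    σ-functional e h h′ =
      mk≋ (proj₂ (proj₂ (proj₂ (proj₂ (proj₁ strategy)))) _ _ _ h
            (⇒App (∊-respˡ (⟪⟫-cong (≋-sym e) ≋-refl) (App⇒ {σ} h′))))

  abstract
    reply : ∀ c t → ∃[ i ] (App σ (seq (c ∷ t)) (τ ! i) × T (proj₁ c i))
    reply c t =
      let u , 𝒰 , σ-app , s-app , u∈𝒰 =
            proj₂ strategy (numeral (length t)) (un∊ (numeral∊w _)) (numeral (suc (length t)))
              (seq (c ∷ t)) (⇒Succ ≋-refl) (seq-CoverSequence (c ∷ t))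
          𝒰≋c = mk≋ (proj₂ (proj₂ (proj₁ (seq-CoverSequence (c ∷ t)))) _ _ _ s-app (⇒App (seq⁺ here)))
          (i , h) , u≋ = ∊-elim (∊-respʳ 𝒰≋c (mk∊ u∈𝒰))
      in i , ⇒App (∊-respˡ (⟪⟫-cong ≋-refl u≋) (App⇒ {σ} σ-app)) , h

  answer : Cover → List Cover → Index τ
  answer c t = proj₁ (reply c t)

  infix 4 _≋*_
  _≋*_ : List Cover → List Cover → Set₁
  _≋*_ = Pointwise (λ c c′ → cover c ≋ cover c′)

  At-cong : ∀ {t t′ k c} → t ≋* t′ → At t k c → ∃[ c′ ] (At t′ k c′ × cover c ≋ cover c′)
  At-cong {t} (e ∷ es) here = _ , subst (λ n → At _ n _) (sym (Pointwise-length es)) here , e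
  At-cong (_ ∷ es) (there h) = let c′ , h′ , e = At-cong es h in c′ , there h′ , e

  seq-cong : ∀ {t t′} → t ≋* t′ → seq t ≋ seq t′
  seq-cong {t} {t′} es = ≋-ext (incl es) (incl (symmetric ≋-sym es))
    where
    incl : ∀ {t t′ x} → t ≋* t′ → x ∊ seq t → x ∊ seq t′
    incl {t} es x∊ =
      let (k , c , h) , e = ∊-elim {a = seq t} x∊ ; c′ , h′ , e′ = At-cong es h
      in ∊-respˡ (≋-sym (≋-trans e (⟪⟫-cong ≋-refl e′))) (seq⁺ h′)

  -- The strategy is a functional set of pairs, so plays that agree up to `≋` get the same answer.
  -- This is what makes uniqueness of runs up to `≋` sufficient later.
  answer-cong : ∀ {c c′ t t′} → cover c ≋ cover c′ → t ≋* t′ →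
                τ ! answer c t ≋ τ ! answer c′ t′
  answer-cong {c} {c′} {t} {t′} e es =
    σ-functional (seq-cong (e ∷ es)) (proj₁ (proj₂ (reply c t))) (proj₁ (proj₂ (reply c′ t′)))

  -- Otherwise the open sets that are never an answer form a cover, and the
  -- answer to it is such a set.
  every-neighbourhood-answered :
    ∀ t → ∃[ x ] (∀ U → X ! x ∊ τ ! U → ∃[ c ] (τ ! answer c t ≋ τ ! U))
  every-neighbourhood-answered t = dne λ none → refute (decide⁺ (𝒩-open none))
    where
    Answered : Index τ → Set₁
    Answered U = ∃[ c ] (τ ! answer c t ≋ τ ! U)
    𝒩 : Index τ → Bool
    𝒩 U = decide (¬ Answered U)
    refute : ¬ T (decide (𝕃.OpenCover X τ (𝒫 τ ! 𝒩)))
    refute h = decide⁻ {¬ Answered (answer (𝒩 , h) t)} 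
      (proj₂ (proj₂ (reply (𝒩 , h) t))) ((𝒩 , h) , ≋-refl {τ ! answer (𝒩 , h) t})
    ¬→ : {A B : Set₁} → ¬ (A → B) → A × ¬ B
    ¬→ ¬f = dne (λ ¬a → ¬f λ a → ⊥-elim (¬a a)) , λ b → ¬f λ _ → b
    𝒩-open : ¬ (∃[ x ] (∀ U → X ! x ∊ τ ! U → Answered U)) → 𝕃.OpenCover X τ (𝒫 τ ! 𝒩)
    𝒩-open none =
        (λ { u ((U , _) , e) → U , e })
      , λ y y∈ → let x , e = ∊-elim {a = X} (mk∊ y∈)
                     U , ¬h = ¬∀⇒∃¬ {B = λ U → X ! x ∊ τ ! U → Answered U} (λ h → none (x , h))
                     x∊U , ¬ans = ¬→ {X ! x ∊ τ ! U} {Answered U} ¬h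
                 in τ ! U , ((U , decide⁺ {¬ Answered U} ¬ans) , ≈-refl (τ ! U))
                    , un∊ (∊-respˡ (≋-sym e) x∊U)

  initial : (ℕ → Cover) → ℕ → List Cover
  initial g zero    = []
  initial g (suc n) = g n ∷ initial g n

  length-initial : ∀ g n → length (initial g n) ≡ n
  length-initial g zero    = refl
  length-initial g (suc n) = cong suc (length-initial g n)

  At-initial : ∀ g {n k} → k < n → At (initial g n) k (g k)
  At-initial g {suc n} (s≤s k≤n) with m≤n⇒m<n∨m≡n k≤n
  ... | inj₁ k<n  = there (At-initial g k<n)
  ... | inj₂ refl = subst (λ m → At (initial g (suc n)) m (g n)) (length-initial g n) here

  answers-cover : ∀ g x → ∃[ n ] (X ! x ∊ τ ! answer (g n) (initial g n))
  answers-cover g x =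
    let i , i∈w , m , s , u , succ-m , restr , σ-app , x∈u =
          winning F F-CoverSequence (X ! x) (un∊ (!-∊ X x))
        n , i≋n = ∊-elim (∊-respʳ w≋ω (mk∊ i∈w))
        s≋ = restriction (≋-trans (Succ⇒ {i} {m} succ-m) (succ-cong i≋n)) restr
        u≋ = σ-functional s≋ σ-app (proj₁ (proj₂ (reply (g n) (initial g n))))
    in n , ∊-respʳ u≋ (mk∊ x∈u)
    where
    F : V
    F = sup ℕ λ k → ⟪ numeral k , cover (g k) ⟫
    F-CoverSequence : 𝕃.CoverSequence X τ F w
    F-CoverSequence = CoverSequenceFrom ℕ (λ k → k) g (cong g) ≋-refl numeral∊w
      (λ y∊ → ∊-elim (∊-respʳ w≋ω y∊))
    restriction : ∀ {s m n} → m ≋ numeral n → 𝕃.Restriction s F m → s ≋ seq (initial g n)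
    restriction {s} {m} {n} m≋n h = ≋-ext
      (λ { {z} (mk∊ z∈s) →
        let z∈F , x , x∈m , y , hz = proj₁ (h z) z∈s
            k , z≋ = ∊-elim {a = F} (mk∊ z∈F)
            k′ , k′< , x≋ = ∊-numeral⁻ n (∊-respʳ m≋n (mk∊ x∈m))
            k≡k′ = numeral-injective (≋-trans (⟪⟫-injˡ (≋-trans (≋-sym z≋) (OPair⇒ hz))) x≋)
        in ∊-respˡ (≋-sym z≋) (seq⁺ (At-initial g (subst (_< n) (sym k≡k′) k′<))) })
      (λ {z} z∊ →
        let (k , c , hk) , z≋ = ∊-elim {a = seq (initial g n)} z∊
            k< = subst (k <_) (length-initial g n) (At⇒< hk)
            c≡ = At-functional hk (At-initial g k<)
        in mk∊ (proj₂ (h z)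
             ( un∊ (∊-intro F k (≋-trans z≋ (⟪⟫-cong ≋-refl (≡⇒≋ (cong cover c≡)))))
             , numeral k , un∊ (∊-respʳ (≋-sym m≋n) (numeral-< k<)) , cover c , ⇒OPair z≋)))

  -- Well-foundedness of the tree of plays missing `x`, in the form of an inductive bar. Recursion
  -- on it can be carried out below any condition.
  data Secured (x : Index X) : List Cover → Set₁ where
    covered : ∀ {c t} → X ! x ∊ τ ! answer c t → Secured x (c ∷ t)
    later   : ∀ {t} → (∀ c → Secured x (c ∷ t)) → Secured x t

  -- Since every infinite run covers x, the tree of partial plays that do not
  -- cover x is well-founded.
  all-secured : ∀ x → Secured x []
  all-secured x = dne refute
    where
    Unsecured : Set₁
    Unsecured = Σ[ t ∈ List Cover ] ¬ Secured x t
    bad-move : (u : Unsecured) → ∃[ c ] ¬ Secured x (c ∷ proj₁ u)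
    bad-move (t , h) = ¬∀⇒∃¬ {B = λ c → Secured x (c ∷ t)} λ s → h (later s)
    run : Unsecured → ℕ → Unsecured
    run u zero    = u
    run u (suc n) = proj₁ (bad-move (run u n)) ∷ proj₁ (run u n) , proj₂ (bad-move (run u n))
    moves : Unsecured → ℕ → Cover
    moves u n = proj₁ (bad-move (run u n))
    run≡ : ∀ h n → proj₁ (run ([] , h) n) ≡ initial (moves ([] , h)) n
    run≡ h zero    = refl
    run≡ h (suc n) = cong (moves ([] , h) n ∷_) (run≡ h n)
    refute : ¬ ¬ Secured x []
    refute h =
      let g = moves ([] , h)
          n , x∊ = answers-cover g x
      in subst (λ t → ¬ Secured x t) (run≡ h (suc n)) (proj₂ (run ([] , h) (suc n)))
           (covered {x} {g n} {initial g n} x∊)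

-- Calculus of dense forcing, names and nice names.

module Names (em : ExcludedMiddle (lsuc 0ℓ)) (P R : V) (poset : Poset P R) where
  open Decide em
  open Forcing P R

  infix 4 _⊴_

  record _⊴_ (p q : Cond) : Set₁ where
    constructor mk⊴
    field un⊴ : p ≤ q
  open _⊴_ public

  ⊴-refl : ∀ {p} → p ⊴ p
  ⊴-refl {p} = mk⊴ (proj₁ (proj₂ poset) (P ! p) (un∊ (!-∊ P p)))

  ⊴-trans : ∀ {p q r} → p ⊴ q → q ⊴ r → p ⊴ r
  ⊴-trans (mk⊴ l) (mk⊴ l′) = mk⊴ (proj₂ (proj₂ poset) _ _ _ l l′)

  -- The modality of forcing an existential or a disjunction. It is a monad on predicates of
  -- conditions: `η` needs the predicate at all stronger conditions, and `_>>=_` passes to a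
  -- condition at which a witness is known.
  record D (p : Cond) (φ : Cond → Set₁) : Set₁ where
    constructor mkD
    field below : ∀ {q} → q ⊴ p → ∃[ r ] (r ⊴ q × φ r)
  open D public

  private variable
    p q r : Cond
    φ ψ : Cond → Set₁

  η : (∀ {q} → q ⊴ p → φ q) → D p φ
  η h = mkD λ l → _ , ⊴-refl , h l

  infixl 1 _>>=_
  _>>=_ : D p φ → (∀ {q} → q ⊴ p → φ q → D q ψ) → D p ψ
  d >>= k = mkD λ l → let r , r⊴q , h = below d l
                          r′ , r′⊴r , h′ = below (k (⊴-trans r⊴q l) h) ⊴-refl
                      in r′ , ⊴-trans r′⊴r r⊴q , h′

  D-map : (∀ {q} → q ⊴ p → φ q → ψ q) → D p φ → D p ψ
  D-map k d = mkD λ l → let r , r⊴q , h = below d l in r , r⊴q , k (⊴-trans r⊴q l) h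

  D↓ : q ⊴ p → D p φ → D q φ
  D↓ l d = mkD λ l′ → below d (⊴-trans l′ l)

  D-witness : D p φ → ∃[ r ] (r ⊴ p × φ r)
  D-witness d = below d ⊴-refl

  toD : ∀ p → DenselyBelow p φ → D p φ
  toD p d = mkD λ {q} l → let r , l′ , h = d q (un⊴ l) in r , mk⊴ l′ , h

  fromD : D p φ → DenselyBelow p φ
  fromD d q l = let r , l′ , h = below d (mk⊴ l) in r , un⊴ l′ , h

  record Eq (a b : Name) (p : Cond) : Set₁ where
    constructor mkEq
    field unEq : (a ≐ᶠ b) p
  open Eq public

  record Mem (a b : Name) (p : Cond) : Set₁ where
    constructor mkMem
    field unMem : (a ∈ᶠ b) p
  open Mem public

  private variable
    a b c d : Name

  Eq-intro : ∀ {I x s J y t} →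
    (∀ i {q} → q ⊴ p → q ⊴ s i → D q λ r → ∃[ j ] (r ⊴ t j × Eq (x i) (y j) r)) →
    (∀ j {q} → q ⊴ p → q ⊴ t j → D q λ r → ∃[ i ] (r ⊴ s i × Eq (x i) (y j) r)) →
    Eq (name I x s) (name J y t) p
  Eq-intro l r = mkEq
    ( (λ i q l₁ l₂ → fromD (D-map (λ { _ (j , h , e) → j , un⊴ h , unEq e }) (l i (mk⊴ l₁) (mk⊴ l₂))))
    , (λ j q l₁ l₂ → fromD (D-map (λ { _ (i , h , e) → i , un⊴ h , unEq e }) (r j (mk⊴ l₁) (mk⊴ l₂)))))

  Eq-elimˡ : ∀ {I x s J y t} → Eq (name I x s) (name J y t) p →
             ∀ i {q} → q ⊴ p → q ⊴ s i → D q λ r → ∃[ j ] (r ⊴ t j × Eq (x i) (y j) r)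
  Eq-elimˡ (mkEq (h , _)) i {q} l l′ =
    D-map (λ { _ (j , k , e) → j , mk⊴ k , mkEq e }) (toD q (h i q (un⊴ l) (un⊴ l′)))

  Eq-elimʳ : ∀ {I x s J y t} → Eq (name I x s) (name J y t) p →
             ∀ j {q} → q ⊴ p → q ⊴ t j → D q λ r → ∃[ i ] (r ⊴ s i × Eq (x i) (y j) r)
  Eq-elimʳ (mkEq (_ , h)) j {q} l l′ =
    D-map (λ { _ (i , k , e) → i , mk⊴ k , mkEq e }) (toD q (h j q (un⊴ l) (un⊴ l′)))

  Mem-intro : ∀ {J y t} → D p (λ r → ∃[ j ] (r ⊴ t j × Eq a (y j) r)) → Mem a (name J y t) p
  Mem-intro d = mkMem (fromD (D-map (λ { _ (j , h , e) → j , un⊴ h , unEq e }) d))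

  Mem-elim : ∀ {J y t} → Mem a (name J y t) p → D p (λ r → ∃[ j ] (r ⊴ t j × Eq a (y j) r))
  Mem-elim (mkMem d) = D-map (λ { _ (j , h , e) → j , mk⊴ h , mkEq e }) (toD _ d)

  Eq-refl : Eq a a p
  Eq-refl {name I x s} = Eq-intro
    (λ i _ l → η λ l′ → i , ⊴-trans l′ l , Eq-refl {x i})
    (λ i _ l → η λ l′ → i , ⊴-trans l′ l , Eq-refl {x i})

  Eq-sym : Eq a b p → Eq b a p
  Eq-sym {name I x s} {name J y t} e = Eq-intro
    (λ j l l′ → D-map (λ { _ (i , h , e′) → i , h , Eq-sym {x i} {y j} e′ }) (Eq-elimʳ e j l l′))
    (λ i l l′ → D-map (λ { _ (j , h , e′) → j , h , Eq-sym {x i} {y j} e′ }) (Eq-elimˡ e i l l′))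

  Eq↓ : q ⊴ p → Eq a b p → Eq a b q
  Eq↓ {a = name _ _ _} {b = name _ _ _} l e =
    Eq-intro (λ i l′ → Eq-elimˡ e i (⊴-trans l′ l)) (λ j l′ → Eq-elimʳ e j (⊴-trans l′ l))

  Eq-trans : Eq a b p → Eq b c p → Eq a c p
  Eq-trans {name I x s} {name J y t} {c = name K z u} e e′ = Eq-intro
    (λ i l l′ → Eq-elimˡ e i l l′ >>= λ { l₁ (j , h , f) →
                D-map (λ { l₂ (k , h′ , f′) → k , h′ , Eq-trans {x i} {y j} (Eq↓ l₂ f) f′ })
                      (Eq-elimˡ e′ j (⊴-trans l₁ l) h) })
    (λ k l l′ → Eq-elimʳ e′ k l l′ >>= λ { l₁ (j , h , f) →
                D-map (λ { l₂ (i , h′ , f′) → i , h′ , Eq-trans {x i} {y j} f′ (Eq↓ l₂ f) })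
                      (Eq-elimʳ e j (⊴-trans l₁ l) h) })

  -- The clauses defining forced equality are already density statements, so nothing is gained by
  -- asking for it only densely. This removes `D` whenever the goal is an equality.
  Eq-local : D p (Eq a b) → Eq a b p
  Eq-local {a = name _ _ _} {b = name _ _ _} d = Eq-intro
    (λ i l l′ → D↓ l d >>= λ l₁ e → Eq-elimˡ e i ⊴-refl (⊴-trans l₁ l′))
    (λ j l l′ → D↓ l d >>= λ l₁ e → Eq-elimʳ e j ⊴-refl (⊴-trans l₁ l′))

  Mem↓ : q ⊴ p → Mem a b p → Mem a b q
  Mem↓ {b = name _ _ _} l h = Mem-intro (D↓ l (Mem-elim h))

  Mem-local : D p (Mem a b) → Mem a b p
  Mem-local {b = name _ _ _} d = Mem-intro (d >>= λ _ h → Mem-elim h)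

  Mem-respˡ : Eq a c p → Mem a b p → Mem c b p
  Mem-respˡ {b = name _ _ _} e h =
    Mem-intro (D-map (λ { l (j , k , f) → j , k , Eq-trans (Eq-sym (Eq↓ l e)) f }) (Mem-elim h))

  Mem-respʳ : Eq b c p → Mem a b p → Mem a c p
  Mem-respʳ {b = name _ _ _} {c = name _ _ _} e h =
    Mem-intro (Mem-elim h >>= λ { l (j , k , f) →
      D-map (λ { l′ (i , k′ , f′) → i , k′ , Eq-trans (Eq↓ l′ f) f′ }) (Eq-elimˡ e j l k) })

  ext : (∀ {x q} → q ⊴ p → Mem x a q → Mem x b q) → (∀ {x q} → q ⊴ p → Mem x b q → Mem x a q) →
        Eq a b p
  ext {a = name _ x s} {b = name _ y t} l r = Eq-intro
    (λ i k k′ → Mem-elim (l k (Mem-intro (η λ k₁ → i , ⊴-trans k₁ k′ , Eq-refl))))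
    (λ j k k′ → D-map (λ { _ (i , h , e) → i , h , Eq-sym e })
                  (Mem-elim (r k (Mem-intro (η λ k₁ → j , ⊴-trans k₁ k′ , Eq-refl)))))

  Persistent : (Cond → Set₁) → Set₁
  Persistent φ = ∀ {p q} → q ⊴ p → φ p → φ q

  -- Every member is paired with every condition, which does the work of a largest condition.
  full : {I : Set} → (I → Name) → Name
  full {I} x = name (I × Cond) (λ { (i , _) → x i }) proj₂

  full⁺ : ∀ {I} {x : I → Name} i → Eq a (x i) p → Mem a (full x) p
  full⁺ i e = Mem-intro (η λ {q} l → (i , q) , ⊴-refl , Eq↓ l e)

  full⁻ : ∀ {I} {x : I → Name} → Mem a (full x) p → D p λ r → ∃[ i ] Eq a (x i) r
  full⁻ h = D-map (λ { _ ((i , _) , _ , e) → i , e }) (Mem-elim h)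

  -- The names for subsets of the values of `x` that are coded by Boolean functions. They are
  -- indexed by a `Set`, so a name may have all of them as members.
  sub : {I : Set} → (I → Name) → (I × Cond → Bool) → Name
  sub {I} x χ = name (Σ[ k ∈ I × Cond ] T (χ k)) (λ { ((i , _) , _) → x i }) (λ { ((_ , q) , _) → q })

  [_∣_] : {I : Set} → (I → Name) → (I → Cond → Set₁) → Name
  [ x ∣ φ ] = sub x λ { (i , q) → decide (φ i q) }

  comp⁺ : ∀ {I} {x : I → Name} {φ : I → Cond → Set₁} → (∀ i → Persistent (φ i)) →
          ∀ i → φ i p → Eq a (x i) p → Mem a [ x ∣ φ ] p
  comp⁺ φ↓ i h e = Mem-intro (η λ {q} l → ((i , q) , decide⁺ (φ↓ i l h)) , ⊴-refl , Eq↓ l e)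

  comp⁻ : ∀ {I} {x : I → Name} {φ : I → Cond → Set₁} → (∀ i → Persistent (φ i)) →
          Mem a [ x ∣ φ ] p → D p λ r → ∃[ i ] (φ i r × Eq a (x i) r)
  comp⁻ φ↓ h = D-map (λ { _ (((i , q) , k) , l , e) → i , φ↓ i l (decide⁻ k) , e }) (Mem-elim h)

  nice : {I : Set} → (I → Name) → Name → (I × Cond → Bool)
  nice x a (i , q) = decide (Mem (x i) a q)

  -- The nice-name argument: record for each `i` the conditions that force `x i` into `a`. Power
  -- sets of V[G] thereby become indexed by sets of V.
  Eq-nice : ∀ {I} {x : I → Name} →
            (∀ {y q} → q ⊴ p → Mem y a q → D q λ r → ∃[ i ] Eq y (x i) r) → Eq a (sub x (nice x a)) p
  Eq-nice {a = a} {x = x} h = ext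
    (λ l y∈a → Mem-local (D-map (λ { l′ (i , e) →
       comp⁺ {φ = λ i → Mem (x i) a} (λ _ → Mem↓) i (Mem-respˡ e (Mem↓ l′ y∈a)) e }) (h l y∈a)))
    (λ l y∈ → Mem-local (D-map (λ { _ (i , k , e) → Mem-respˡ (Eq-sym e) k })
       (comp⁻ {φ = λ i → Mem (x i) a} (λ _ → Mem↓) y∈)))

  Extensional : (Name → Cond → Set₁) → Set₁
  Extensional φ = ∀ {a b p} → Eq a b p → φ a p → φ b p

  separate : Name → (Name → Cond → Set₁) → Name
  separate (name J y t) φ = [ y ∣ (λ j r → r ⊴ t j × φ (y j) r) ]

  separate⁺ : ∀ {φ} → (∀ {x} → Persistent (φ x)) → Extensional φ →
              Mem a b p → φ a p → Mem a (separate b φ) p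
  separate⁺ {b = name J y t} φ↓ φ-ext h k = Mem-local (D-map (λ { l (j , l′ , e) →
    comp⁺ (λ _ l₁ → λ { (l₂ , k₂) → ⊴-trans l₁ l₂ , φ↓ l₁ k₂ }) j (l′ , φ-ext e (φ↓ l k)) e }) (Mem-elim h))

  separate⁻ : ∀ {φ} → (∀ {x} → Persistent (φ x)) → Extensional φ →
              Mem a (separate b φ) p → Mem a b p × D p (φ a)
  separate⁻ {b = name J y t} φ↓ φ-ext h =
      Mem-intro (D-map (λ { _ (j , (l , _) , e) → j , l , e }) entry)
    , D-map (λ { _ (j , (_ , k) , e) → φ-ext (Eq-sym e) k }) entry
    where entry = comp⁻ (λ _ l₁ → λ { (l₂ , k₂) → ⊴-trans l₁ l₂ , φ↓ l₁ k₂ }) h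

  check⁺ : ∀ v i → Eq a (check (v ! i)) p → Mem a (check v) p
  check⁺ (sup I f) i e = Mem-intro (η λ {q} l → (i , q) , ⊴-refl , Eq↓ l e)

  check⁻ : ∀ v → Mem a (check v) p → D p λ r → ∃[ i ] Eq a (check (v ! i)) r
  check⁻ (sup I f) h = D-map (λ { _ ((i , _) , _ , e) → i , e }) (Mem-elim h)

  check-cong : ∀ {v w} → v ≋ w → Eq (check v) (check w) p
  check-cong {v = sup I f} {sup J g} (mk≋ (l , r)) = Eq-intro
    (λ { (i , _) _ _ → η λ {q′} _ → let j , e = l i in
         (j , q′) , ⊴-refl , check-cong {v = f i} {g j} (mk≋ e) })
    (λ { (j , _) _ _ → η λ {q′} _ → let i , e = r j in
         (i , q′) , ⊴-refl , check-cong {v = f i} {g j} (mk≋ e) })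

  check-injective : ∀ {v w} → Eq (check v) (check w) p → v ≋ w
  check-injective {v = sup I f} {sup J g} e = mk≋
    ( (λ i → let r , _ , j , e′ = D-witness (check⁻ (sup J g)
                   (Mem-respʳ e (check⁺ (sup I f) i Eq-refl)))
             in j , un≋ (check-injective {v = f i} {g j} e′))
    , (λ j → let r , _ , i , e′ = D-witness (check⁻ (sup I f)
                   (Mem-respʳ (Eq-sym e) (check⁺ (sup J g) j Eq-refl)))
             in i , un≋ (check-injective {v = f i} {g j} (Eq-sym e′))))

  check-∊⁺ : ∀ {v w} → v ∊ w → Mem (check v) (check w) p
  check-∊⁺ {w = w} h = let i , e = ∊-elim h in check⁺ w i (check-cong e)

  check-∊⁻ : ∀ {v w} → Mem (check v) (check w) p → v ∊ w
  check-∊⁻ {w = w} h = let r , _ , i , e = D-witness (check⁻ w h) in ∊-intro w i (check-injective e)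

  check-∊ : ∀ {v} → Mem a (check v) p → D p λ r → ∃[ w ] (w ∊ v × Eq a (check w) r)
  check-∊ {v = v} h = D-map (λ { _ (i , e) → v ! i , !-∊ v i , e }) (check⁻ v h)

  -- Moves are compared in `V` through `code`; this leads from equal codes back to forced equality.
  -- Different indices of `P` may carry the same condition, and such indices lie below each other
  -- because `R` relates the conditions as sets (`same`).
  code-cong : ∀ a b → code a ≋ code b → Eq a b p
  code-cong (name I x s) (name J y t) e = Eq-intro
    (λ i {q} _ q⊴si → η λ l →
      let j , e′ = ∊-elim (∊-respʳ e (!-∊ (code (name I x s)) i))
      in j , ⊴-trans l (⊴-trans q⊴si (same (⟪⟫-injʳ e′))) , code-cong (x i) (y j) (⟪⟫-injˡ e′))
    (λ j {q} _ q⊴tj → η λ l →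
      let i , e′ = ∊-elim (∊-respʳ (≋-sym e) (!-∊ (code (name J y t)) j))
      in i , ⊴-trans l (⊴-trans q⊴tj (same (⟪⟫-injʳ e′)))
           , code-cong (x i) (y j) (≋-sym (⟪⟫-injˡ e′)))
    where
    same : ∀ {p q} → P ! p ≋ P ! q → p ⊴ q
    same {p} e = mk⊴ (un∊ (∊-respˡ (⟪⟫-cong ≋-refl e) (mk∊ {b = R} (un⊴ (⊴-refl {p})))))

  upair opair : Name → Name → Name
  upair a b = full {Bool} λ { true → a ; false → b }
  opair a b = upair (upair a a) (upair a b)

  upairˡ : Eq c a p → Mem c (upair a b) p
  upairˡ = full⁺ true

  upairʳ : Eq c b p → Mem c (upair a b) p
  upairʳ = full⁺ false

  upair⁻ : Mem c (upair a b) p → D p λ r → Eq c a r ⊎ Eq c b r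
  upair⁻ h = D-map (λ { _ (true , e) → inj₁ e ; _ (false , e) → inj₂ e }) (full⁻ h)

  single⁻ : Mem c (upair a a) p → Eq c a p
  single⁻ h = Eq-local (D-map (λ _ → [ (λ e → e) , (λ e → e) ]′) (upair⁻ h))

  upair-cong : Eq a c p → Eq b d p → Eq (upair a b) (upair c d) p
  upair-cong e e′ = Eq-intro
    (λ { (true , _) l _ → η λ l′ → (true , _) , ⊴-refl , Eq↓ (⊴-trans l′ l) e
       ; (false , _) l _ → η λ l′ → (false , _) , ⊴-refl , Eq↓ (⊴-trans l′ l) e′ })
    (λ { (true , _) l _ → η λ l′ → (true , _) , ⊴-refl , Eq↓ (⊴-trans l′ l) e
       ; (false , _) l _ → η λ l′ → (false , _) , ⊴-refl , Eq↓ (⊴-trans l′ l) e′ })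

  opair-cong : Eq a c p → Eq b d p → Eq (opair a b) (opair c d) p
  opair-cong e e′ = upair-cong (upair-cong e e) (upair-cong e e′)

  opair-injˡ : Eq (opair a b) (opair c d) p → Eq a c p
  opair-injˡ e = Eq-local (D-map
    (λ _ → [ (λ h → Eq-sym (single⁻ (Mem-respʳ (Eq-sym h) (upairˡ Eq-refl))))
           , (λ h → Eq-sym (single⁻ (Mem-respʳ (Eq-sym h) (upairˡ Eq-refl)))) ]′)
    (upair⁻ (Mem-respʳ e (upairˡ Eq-refl))))

  opair-injʳ : Eq (opair a b) (opair c d) p → Eq b d p
  opair-injʳ {a = a} {b} {c} {d} {p} e = Eq-local (d≐ >>= λ l h →
    D-map (λ l′ k → conclude (Eq↓ (⊴-trans l′ l) (opair-injˡ e)) k (weaken l′ h)) (D↓ l b≐))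
    where
    weaken : ∀ {p q} → q ⊴ p → Eq d a p ⊎ Eq b d p → Eq d a q ⊎ Eq b d q
    weaken l = [ (λ h → inj₁ (Eq↓ l h)) , (λ h → inj₂ (Eq↓ l h)) ]′
    b≐ : D p λ r → Eq b c r ⊎ Eq b d r
    b≐ = upair⁻ (Mem-respʳ e (upairʳ Eq-refl)) >>= λ _ →
      [ (λ h → η λ l → inj₁ (Eq↓ l (single⁻ (Mem-respʳ h (upairʳ Eq-refl)))))
      , (λ h → upair⁻ (Mem-respʳ h (upairʳ Eq-refl))) ]′
    d≐ : D p λ r → Eq d a r ⊎ Eq b d r
    d≐ = upair⁻ (Mem-respʳ (Eq-sym e) (upairʳ Eq-refl)) >>= λ _ →
      [ (λ h → η λ l → inj₁ (Eq↓ l (single⁻ (Mem-respʳ h (upairʳ Eq-refl)))))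
      , (λ h → D-map (λ _ → [ inj₁ , (λ k → inj₂ (Eq-sym k)) ]′) (upair⁻ (Mem-respʳ h (upairʳ Eq-refl)))) ]′
    conclude : Eq a c q → Eq b c q ⊎ Eq b d q → Eq d a q ⊎ Eq b d q → Eq b d q
    conclude e₁ (inj₂ h) _        = h
    conclude e₁ (inj₁ h) (inj₂ k) = k
    conclude e₁ (inj₁ h) (inj₁ k) = Eq-trans h (Eq-trans (Eq-sym e₁) (Eq-sym k))

-- Forced formulas translated into the calculus of names and back.

module ForcedFormulas (em : ExcludedMiddle (lsuc 0ℓ)) (P R : V) (poset : Poset P R) where
  open Forcing P R
  open Names em P R poset

  private variable
    p q : Cond
    a b c d f x y z n m : Name
    v w : V

  ⊩UPair⁻ : ⊩.UPair z a b p → Eq z (upair a b) p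
  ⊩UPair⁻ h = ext
    (λ {x} {q} l x∈z → Mem-local (D-map (λ _ → [ upairˡ ∘ mkEq , upairʳ ∘ mkEq ]′)
                         (toD q (proj₁ (h x) q (un⊴ l) (unMem x∈z)))))
    (λ {x} {q} l x∈ → mkMem (proj₂ (h x) q (un⊴ l)
                         (fromD (D-map (λ _ → Sum.map unEq unEq) (upair⁻ x∈)))))

  ⊩UPair⁺ : Eq z (upair a b) p → ⊩.UPair z a b p
  ⊩UPair⁺ e x =
      (λ q l x∈z → fromD (D-map (λ _ → Sum.map unEq unEq)
                     (upair⁻ (Mem-respʳ (Eq↓ (mk⊴ l) e) (mkMem x∈z)))))
    , (λ q l h → unMem (Mem-respʳ (Eq-sym (Eq↓ (mk⊴ l) e))
                     (Mem-local (D-map (λ _ → [ upairˡ ∘ mkEq , upairʳ ∘ mkEq ]′) (toD q h)))))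

  ⊩OPair⁻ : ⊩.OPair z a b p → Eq z (opair a b) p
  ⊩OPair⁻ {p = p} h = Eq-local (toD p h >>= λ { {q} _ (u , h′) →
    D-map (λ { _ (v , hu , hv , hz) → Eq-trans (⊩UPair⁻ hz) (upair-cong (⊩UPair⁻ hu) (⊩UPair⁻ hv)) })
          (toD q h′) })

  ⊩OPair⁺ : Eq z (opair a b) p → ⊩.OPair z a b p
  ⊩OPair⁺ e = fromD (η λ l → _ , fromD (η λ l′ → _ , ⊩UPair⁺ Eq-refl , ⊩UPair⁺ Eq-refl
                , ⊩UPair⁺ (Eq↓ (⊴-trans l′ l) e)))

  ⊩App⁻ : ⊩.App f x y p → Mem (opair x y) f p
  ⊩App⁻ {p = p} h = Mem-local (D-map (λ { _ (z , z∈f , hz) → Mem-respˡ (⊩OPair⁻ hz) (mkMem z∈f) }) (toD p h))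

  ⊩App⁺ : Mem (opair x y) f p → ⊩.App f x y p
  ⊩App⁺ h = fromD (η λ l → _ , unMem (Mem↓ l h) , ⊩OPair⁺ Eq-refl)

  record Fun (f d : Name) (p : Cond) : Set₁ where
    field
      graph      : ∀ {z q} → q ⊴ p → Mem z f q →
                   D q λ r → ∃[ x ] ∃[ y ] (Mem x d r × Eq z (opair x y) r)
      total      : ∀ {x q} → q ⊴ p → Mem x d q → D q λ r → ∃[ y ] Mem (opair x y) f r
      functional : ∀ {x y y′ q} → q ⊴ p → Mem (opair x y) f q → Mem (opair x y′) f q → Eq y y′ q

    domain : ∀ {x y q} → q ⊴ p → Mem (opair x y) f q → Mem x d q
    domain l h = Mem-local (D-map (λ { _ (_ , _ , x∈d , e) → Mem-respˡ (Eq-sym (opair-injˡ e)) x∈d }) (graph l h))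
  open Fun public

  ⊩Function⁻ : ⊩.Function f d p → Fun f d p
  ⊩Function⁻ {p = p} (g , t , u) = record
    { graph = λ {z} {q} l z∈f → toD q (g z q (un⊴ l) (unMem z∈f)) >>= λ { {r} l₁ (x , x∈d , h) →
        D-map (λ { l₂ (y , hz) → x , y , Mem↓ l₂ (mkMem x∈d) , ⊩OPair⁻ hz }) (toD r h) }
    ; total = λ {x} {q} l x∈d → D-map (λ { _ (y , h) → y , ⊩App⁻ h })
                                (toD q (t x q (un⊴ l) (unMem x∈d)))
    ; functional = λ {x} {y} {y′} {q} l h h′ →
        mkEq (u x y y′ q (un⊴ l) (⊩App⁺ h) q (un⊴ ⊴-refl) (⊩App⁺ h′))
    }

  ⊩Function⁺ : Fun f d p → ⊩.Function f d p
  ⊩Function⁺ F =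
      (λ z q l z∈f → fromD (D-map (λ { _ (x , y , x∈d , e) →
                         x , unMem x∈d , fromD (η λ l′ → y , ⊩OPair⁺ (Eq↓ l′ e)) })
                       (graph F (mk⊴ l) (mkMem z∈f))))
    , (λ x q l x∈d → fromD (D-map (λ { _ (y , h) → y , ⊩App⁺ h }) (total F (mk⊴ l) (mkMem x∈d))))
    , (λ x y y′ q l h q′ l′ h′ → unEq (functional F (⊴-trans (mk⊴ l′) (mk⊴ l))
         (Mem↓ (mk⊴ l′) (⊩App⁻ h)) (⊩App⁻ h′)))

  Fun↓ : q ⊴ p → Fun f d p → Fun f d q
  Fun↓ l F = record { graph = λ l′ → graph F (⊴-trans l′ l) ; total = λ l′ → total F (⊴-trans l′ l)
                    ; functional = λ l′ → functional F (⊴-trans l′ l) }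

  Fun-resp : ∀ {f′ d′} → Eq f f′ p → Eq d d′ p → Fun f d p → Fun f′ d′ p
  Fun-resp e e′ F = record
    { graph = λ l h → D-map (λ { l′ (x , y , x∈d , k) → x , y , Mem-respʳ (Eq↓ (⊴-trans l′ l) e′) x∈d , k })
                        (graph F l (to l h))
    ; total = λ l h → D-map (λ { l′ (y , k) → y , Mem-respʳ (Eq↓ (⊴-trans l′ l) e) k })
                        (total F l (Mem-respʳ (Eq-sym (Eq↓ l e′)) h))
    ; functional = λ l h h′ → functional F l (to l h) (to l h′) }
    where
    to : q ⊴ _ → Mem x _ q → Mem x _ q
    to l = Mem-respʳ (Eq-sym (Eq↓ l e))

  -- Allows the length of a play to be read off from its sequence of covers.
  domain-unique : ∀ {d′} → Fun f d p → Fun f d′ p → Eq d d′ p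
  domain-unique F F′ = ext (incl F F′) (incl F′ F)
    where
    incl : ∀ {d d′} → Fun _ d _ → Fun _ d′ _ → q ⊴ _ → Mem x d q → Mem x d′ q
    incl F F′ l h = Mem-local (D-map (λ { l′ (y , k) → domain F′ (⊴-trans l′ l) k }) (total F l h))

  record Incl (a b : Name) (p : Cond) : Set₁ where
    constructor mkIncl
    field include : ∀ {x q} → q ⊴ p → Mem x a q → Mem x b q
  open Incl public

  Incl↓ : q ⊴ p → Incl a b p → Incl a b q
  Incl↓ l h = mkIncl λ l′ → include h (⊴-trans l′ l)

  check-Incl : (∀ {u} → u ∊ v → u ∊ w) → Incl (check v) (check w) p
  check-Incl h = mkIncl λ l k → Mem-local (D-map (λ { _ (u , u∊v , e) →
    Mem-respˡ (Eq-sym e) (check-∊⁺ (h u∊v)) }) (check-∊ k))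

  check-succ⁻ : Mem x (check (succ v)) p → D p λ r → Mem x (check v) r ⊎ Eq x (check v) r
  check-succ⁻ h = D-map (λ { _ (u , u∊ , e) →
    [ (λ k → inj₁ (Mem-respˡ (Eq-sym e) (check-∊⁺ k))) , (λ k → inj₂ (Eq-trans e (check-cong k))) ]′
      (∊-succ⁻ u∊) }) (check-∊ h)

  check-succˡ : Mem x (check v) p → Mem x (check (succ v)) p
  check-succˡ = include (check-Incl ∊-succˡ) ⊴-refl

  check-succʳ : Eq x (check v) p → Mem x (check (succ v)) p
  check-succʳ e = Mem-respˡ (Eq-sym e) (check-∊⁺ (∊-succʳ ≋-refl))

  ⊩Succ⁻ : Eq n (check v) p → ⊩.Succ n m p → Eq m (check (succ v)) p
  ⊩Succ⁻ e h = ext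
    (λ {x} {q} l x∈m → Mem-local (D-map
       (λ l′ → [ (λ k → check-succˡ (Mem-respʳ (Eq↓ (⊴-trans l′ l) e) (mkMem k)))
               , (λ k → check-succʳ (Eq-trans (mkEq k) (Eq↓ (⊴-trans l′ l) e))) ]′)
       (toD q (proj₁ (h x) q (un⊴ l) (unMem x∈m)))))
    (λ {x} {q} l x∈ → mkMem (proj₂ (h x) q (un⊴ l) (fromD (D-map
       (λ l′ → [ (λ k → inj₁ (unMem (Mem-respʳ (Eq-sym (Eq↓ (⊴-trans l′ l) e)) k)))
               , (λ k → inj₂ (unEq (Eq-trans k (Eq-sym (Eq↓ (⊴-trans l′ l) e))))) ]′)
       (check-succ⁻ x∈)))))

  ⊩Succ⁺ : Eq n (check v) p → Eq m (check (succ v)) p → ⊩.Succ n m p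
  ⊩Succ⁺ e e′ x =
      (λ q l x∈m → fromD (D-map
        (λ l′ → [ (λ k → inj₁ (unMem (Mem-respʳ (Eq-sym (Eq↓ (⊴-trans l′ (mk⊴ l)) e)) k)))
                , (λ k → inj₂ (unEq (Eq-trans k (Eq-sym (Eq↓ (⊴-trans l′ (mk⊴ l)) e))))) ]′)
        (check-succ⁻ (Mem-respʳ (Eq↓ (mk⊴ l) e′) (mkMem x∈m)))))
    , (λ q l h → unMem (Mem-respʳ (Eq-sym (Eq↓ (mk⊴ l) e′)) (Mem-local (D-map
        (λ l′ → [ (λ k → check-succˡ (Mem-respʳ (Eq↓ (⊴-trans l′ (mk⊴ l)) e) (mkMem k)))
                , (λ k → check-succʳ (Eq-trans (mkEq k) (Eq↓ (⊴-trans l′ (mk⊴ l)) e))) ]′)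
        (toD q h)))))

  ¬Mem-∅ : ¬ Mem x (check ∅) p
  ¬Mem-∅ h with D-witness (check⁻ ∅ h)
  ... | _ , _ , () , _

  abstract
    num : ℕ → Name
    num k = check (numeral k)

    num-injective : ∀ {k l} → Eq (num k) (num l) p → k ≡ l
    num-injective e = numeral-injective (check-injective e)

    num∈num : ∀ {k n} → k < n → Mem (num k) (num n) p
    num∈num k<n = check-∊⁺ (numeral-< k<n)

    num⁻ : ∀ {x} n → Mem x (num n) p → D p λ r → ∃[ k ] (k < n × Eq x (num k) r)
    num⁻ n h = D-map (λ { _ (v , v∊n , e) → let k , k<n , e′ = ∊-numeral⁻ n v∊n in
      k , k<n , Eq-trans e (check-cong e′) }) (check-∊ h)

    num∈ω : ∀ k → Mem (num k) (check ω) p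
    num∈ω k = check⁺ ω k Eq-refl

    ω⁻ : Mem x (check ω) p → D p λ r → ∃[ k ] Eq x (num k) r
    ω⁻ = check⁻ ω

    num-zero⁻ : ¬ Mem x (num 0) p
    num-zero⁻ = ¬Mem-∅

    ⊩Succ-num⁻ : ∀ {k} → Eq n (num k) p → ⊩.Succ n m p → Eq m (num (suc k)) p
    ⊩Succ-num⁻ = ⊩Succ⁻

    ⊩Succ-num⁺ : ∀ {k} → Eq n (num k) p → Eq m (num (suc k)) p → ⊩.Succ n m p
    ⊩Succ-num⁺ = ⊩Succ⁺

  -- Each member of `check ω` is densely a numeral, and induction outside the forcing language puts
  -- every numeral into every inductive name.
  ⊩Omega : ∀ p → ⊩.Omega (check ω) p
  ⊩Omega p =
      ( fromD (η λ _ → num 0 , unMem (num∈ω 0) , λ x q l h → lift (num-zero⁻ (mkMem h)))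
      , λ n q l n∈ω → fromD (D-map (λ { _ (k , e) →
          num (suc k) , unMem (num∈ω (suc k)) , ⊩Succ-num⁺ e Eq-refl }) (ω⁻ (mkMem n∈ω))) )
    , λ v q l ind x q′ l′ x∈ω → unMem (Mem-local (D-map (λ { l₁ (k , e) →
          Mem-respˡ (Eq-sym e) (Mem↓ (⊴-trans l₁ (mk⊴ l′)) (num∈ ind k)) }) (ω⁻ (mkMem x∈ω))))
    where
    num∈ : ⊩.Inductive a q → ∀ k → Mem (num k) a q
    num∈ {q = q} (zero∈ , _) zero = Mem-local (D-map (λ { {r} _ (e , e∈ , empty) →
      Mem-respˡ (ext (λ {y} {q′} l h → ⊥-elim (lower (empty y q′ (un⊴ l) (unMem h))))
                     (λ _ h → ⊥-elim (num-zero⁻ h))) (mkMem e∈) })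
      (toD q zero∈))
    num∈ {q = q} ind@(_ , succ∈) (suc k) = Mem-local (D-map (λ { _ (m , m∈ , h) →
      Mem-respˡ (⊩Succ-num⁻ Eq-refl h) (mkMem m∈) })
      (toD q (succ∈ (num k) q (un⊴ ⊴-refl) (unMem (num∈ ind k)))))

  record Cov (X τ 𝒰 : Name) (p : Cond) : Set₁ where
    field
      opens : ∀ {u q} → q ⊴ p → Mem u 𝒰 q → Mem u τ q
      cover : ∀ {x q} → q ⊴ p → Mem x X q → D q λ r → ∃[ u ] (Mem u 𝒰 r × Mem x u r)
  open Cov public

  ⊩OpenCover⁻ : ∀ {X τ 𝒰} → ⊩.OpenCover X τ 𝒰 p → Cov X τ 𝒰 p
  ⊩OpenCover⁻ (o , c) = record
    { opens = λ {u} {q} l h → mkMem (o u q (un⊴ l) (unMem h))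
    ; cover = λ {x} {q} l h → D-map (λ { _ (u , u∈ , k) → u , mkMem u∈ , mkMem k })
                          (toD q (c x q (un⊴ l) (unMem h))) }

  ⊩OpenCover⁺ : ∀ {X τ 𝒰} → Cov X τ 𝒰 p → ⊩.OpenCover X τ 𝒰 p
  ⊩OpenCover⁺ C =
      (λ u q l h → unMem (opens C (mk⊴ l) (mkMem h)))
    , (λ x q l h → fromD (D-map (λ { _ (u , u∈ , k) → u , unMem u∈ , unMem k })
                       (cover C (mk⊴ l) (mkMem h))))

  record CovSeq (X τ s d : Name) (p : Cond) : Set₁ where
    field
      fun    : Fun s d p
      covers : ∀ {i 𝒰 q} → q ⊴ p → Mem (opair i 𝒰) s q → Cov X τ 𝒰 q
  open CovSeq public

  ⊩CoverSequence⁻ : ∀ {X τ s} → ⊩.CoverSequence X τ s d p → CovSeq X τ s d p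
  ⊩CoverSequence⁻ (F , c) = record
    { fun = ⊩Function⁻ F
    ; covers = λ {i} {𝒰} {q} l h → ⊩OpenCover⁻ (c i 𝒰 q (un⊴ l) (⊩App⁺ h)) }

  ⊩CoverSequence⁺ : ∀ {X τ s} → CovSeq X τ s d p → ⊩.CoverSequence X τ s d p
  ⊩CoverSequence⁺ S = ⊩Function⁺ (fun S) , λ i 𝒰 q l h → ⊩OpenCover⁺ (covers S (mk⊴ l) (⊩App⁻ h))

  CovSeq↓ : ∀ {X τ s} → q ⊴ p → CovSeq X τ s d p → CovSeq X τ s d q
  CovSeq↓ l S = record { fun = Fun↓ l (fun S) ; covers = λ l′ → covers S (⊴-trans l′ l) }

  CovSeq-resp : ∀ {X τ s s′ d d′} → Eq s s′ p → Eq d d′ p → CovSeq X τ s d p → CovSeq X τ s′ d′ p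
  CovSeq-resp e e′ S = record
    { fun = Fun-resp e e′ (fun S)
    ; covers = λ l h → covers S l (Mem-respʳ (Eq-sym (Eq↓ l e)) h) }

-- The topology of V[G] that has `τ` as a basis.

module GeneratedTopology (em : ExcludedMiddle (lsuc 0ℓ)) (X τ P R : V)
                         (top : Topology X τ) (poset : Poset P R) where
  open Forcing P R
  open Decide em
  open Names em P R poset
  open ForcedFormulas em P R poset

  private variable
    p q : Cond
    a b x : Name

  record IsOpen (a : Name) (p : Cond) : Set₁ where
    constructor mkIsOpen
    field neighbourhood : ∀ {x q} → q ⊴ p → Mem x a q →
                          D q λ r → ∃[ i ] (Mem x (check (τ ! i)) r × Incl (check (τ ! i)) a r)
  open IsOpen public

  IsOpen↓ : q ⊴ p → IsOpen a p → IsOpen a q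
  IsOpen↓ l o = mkIsOpen λ l′ → neighbourhood o (⊴-trans l′ l)

  Subset : Set
  Subset = Index X × Cond → Bool

  point : Index X → Name
  point i = check (X ! i)

  subset : Subset → Name
  subset = sub point

  -- Only coded names are listed as members, yet no open set of V[G] is lost: every name for a
  -- subset of `X` is forced equal to a coded one by `Eq-subset`.
  τ̇ : Name
  τ̇ = [ subset ∣ (λ χ → IsOpen (subset χ)) ]

  Eq-subset : Incl a (check X) p → Eq a (subset (nice point a)) p
  Eq-subset h = Eq-nice λ l y∈a → check⁻ X (include h l y∈a)

  τ̇⁺ : Incl a (check X) p → IsOpen a p → Mem a τ̇ p
  τ̇⁺ {a} h o = comp⁺ (λ _ → IsOpen↓) (nice point a)
    (mkIsOpen λ l x∈ → D-map
       (λ { l′ (i , x∈i , i⊆) → i , x∈i , mkIncl λ l₁ k →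
              Mem-respʳ (Eq↓ (⊴-trans l₁ (⊴-trans l′ l)) (Eq-subset h)) (include i⊆ l₁ k) })
       (neighbourhood o l (Mem-respʳ (Eq-sym (Eq↓ l (Eq-subset h))) x∈)))
    (Eq-subset h)

  τ̇-subset : Mem a τ̇ p → D p λ r → ∃[ χ ] Eq a (subset χ) r
  τ̇-subset h = D-map (λ { _ (χ , _ , e) → χ , e }) (comp⁻ (λ _ → IsOpen↓) h)

  τ̇⊆X : Mem a τ̇ p → Incl a (check X) p
  τ̇⊆X h = mkIncl λ l x∈a → Mem-local (τ̇-subset (Mem↓ l h) >>= λ { l₁ (χ , e) →
    D-map (λ { _ (((i , _) , _) , _ , e′) → Mem-respˡ (Eq-sym e′) (check⁺ X i Eq-refl) })
          (Mem-elim (Mem-respʳ e (Mem↓ l₁ x∈a))) })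

  τ̇-open : Mem a τ̇ p → IsOpen a p
  τ̇-open h = mkIsOpen λ l x∈a → comp⁻ (λ _ → IsOpen↓) (Mem↓ l h) >>= λ { l₁ (χ , o , e) →
    D-map (λ { l₂ (i , x∈i , i⊆) → i , x∈i , mkIncl λ l₃ k →
             Mem-respʳ (Eq-sym (Eq↓ (⊴-trans l₃ l₂) e)) (include i⊆ l₃ k) })
          (neighbourhood o ⊴-refl (Mem-respʳ e (Mem↓ l₁ x∈a))) }

  basic-open : ∀ i → Mem (check (τ ! i)) τ̇ p
  basic-open i = τ̇⁺
    (check-Incl λ {u} u∊ → mk∊ (proj₁ top (τ ! i) (un∊ (!-∊ τ i)) u (un∊ u∊)))
    (mkIsOpen λ l x∈ → η λ l′ → i , Mem↓ l′ x∈ , mkIncl λ _ k → k)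

  private
    V-inter : ∀ i j → ∃[ k ] ((∀ {y} → y ∊ τ ! k → y ∊ τ ! i × y ∊ τ ! j) ×
                              (∀ {y} → y ∊ τ ! i → y ∊ τ ! j → y ∊ τ ! k))
    V-inter i j =
      let w , w∈τ , h = proj₁ (proj₂ (proj₂ (proj₂ top))) (τ ! i) (un∊ (!-∊ τ i)) (τ ! j) (un∊ (!-∊ τ j))
          k , e = ∊-elim {a = τ} (mk∊ w∈τ)
      in k , (λ {y} y∊ → let h₁ , h₂ = proj₁ (h y) (un∊ (∊-respʳ (≋-sym e) y∊)) in mk∊ h₁ , mk∊ h₂)
           , (λ {y} h₁ h₂ → ∊-respʳ e (mk∊ (proj₂ (h y) (un∊ h₁ , un∊ h₂))))

    Mem-inter : ∀ {i j k} → (∀ {y} → y ∊ τ ! i → y ∊ τ ! j → y ∊ τ ! k) →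
                Mem x (check (τ ! i)) p → Mem x (check (τ ! j)) p → Mem x (check (τ ! k)) p
    Mem-inter h h₁ h₂ = Mem-local (D-map (λ { l (y , y∊ , e) →
      Mem-respˡ (Eq-sym e) (check-∊⁺ (h y∊ (check-∊⁻ (Mem-respˡ e (Mem↓ l h₂))))) }) (check-∊ h₁))

  intersection : Mem a τ̇ p → Mem b τ̇ p →
                 Mem (separate a (λ x → Mem x b)) τ̇ p
  intersection {a} {p} {b} a∈ b∈ = τ̇⁺
    (mkIncl λ l h → include (τ̇⊆X a∈) l (proj₁ (inter⁻ h)))
    (mkIsOpen λ l h → neighbourhood (τ̇-open a∈) l (proj₁ (inter⁻ h)) >>= λ { l₁ (i , x∈i , i⊆) →
      neighbourhood (τ̇-open b∈) (⊴-trans l₁ l) (Mem↓ l₁ (proj₂ (inter⁻ h))) >>= λ { l₂ (j , x∈j , j⊆) →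
      -- In `V` the two basic neighbourhoods intersect in a member of `τ`, which serves as the basic
      -- neighbourhood of the point in the intersection.
      let k , k⊆ , ⊆k = V-inter i j in
      η λ l₃ → k , Mem↓ l₃ (Mem-inter ⊆k (Mem↓ l₂ x∈i) x∈j) , mkIncl λ l₄ m →
        separate⁺ Mem↓ Mem-respˡ
          (include i⊆ (⊴-trans l₄ (⊴-trans l₃ l₂)) (include (check-Incl (λ y∊ → proj₁ (k⊆ y∊))) ⊴-refl m))
          (include j⊆ (⊴-trans l₄ l₃) (include (check-Incl (λ y∊ → proj₂ (k⊆ y∊))) ⊴-refl m)) } })
    where
    inter⁻ : Mem x (separate a (λ x → Mem x b)) q → Mem x a q × Mem x b q
    inter⁻ h = let h₁ , h₂ = separate⁻ Mem↓ Mem-respˡ h in h₁ , Mem-local h₂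

  InUnion : Name → Name → Cond → Set₁
  InUnion s x p = D p λ r → ∃[ u ] (Mem u s r × Mem x u r)

  InUnion-resp : ∀ {s} → Extensional (InUnion s)
  InUnion-resp e = D-map λ { l (u , u∈s , h) → u , u∈s , Mem-respˡ (Eq↓ l e) h }

  union : Name → Name
  union s = separate (check X) (InUnion s)

  union⁻ : ∀ {s} → Mem x (union s) p → InUnion s x p
  union⁻ h = proj₂ (separate⁻ D↓ InUnion-resp h) >>= λ _ k → k

  union⁺ : ∀ {s} → Incl s τ̇ p → InUnion s x p → Mem x (union s) p
  union⁺ s⊆ h = separate⁺ D↓ InUnion-resp
    (Mem-local (D-map (λ { l (u , u∈s , x∈u) → include (τ̇⊆X (include s⊆ l u∈s)) ⊴-refl x∈u }) h)) h

  union-open : ∀ {s} → Incl s τ̇ p → Mem (union s) τ̇ p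
  union-open {s = s} s⊆ = τ̇⁺
    (mkIncl λ l h → proj₁ (separate⁻ {b = check X} {φ = InUnion s} D↓ InUnion-resp h))
    (mkIsOpen λ l h → union⁻ h >>= λ { l₁ (u , u∈s , x∈u) →
      D-map (λ { l₂ (i , x∈i , i⊆) → i , x∈i , mkIncl λ l₃ k →
               union⁺ (Incl↓ (⊴-trans l₃ (⊴-trans l₂ (⊴-trans l₁ l))) s⊆)
                 (η λ l₄ → u , Mem↓ (⊴-trans l₄ (⊴-trans l₃ l₂)) u∈s , Mem↓ l₄ (include i⊆ l₃ k)) })
            (neighbourhood (τ̇-open (include s⊆ (⊴-trans l₁ l) u∈s)) ⊴-refl x∈u) })

  ⊩Topology : ∀ p → ⊩.Topology (check X) τ̇ p
  ⊩Topology p =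
      (λ u q l u∈ x q′ l′ x∈u → unMem (include (τ̇⊆X (mkMem u∈)) (mk⊴ l′) (mkMem x∈u)))
    , fromD (η λ _ → check ∅ , unMem (τ̇⁺ (mkIncl λ _ h → ⊥-elim (¬Mem-∅ h))
                                      (mkIsOpen λ _ h → ⊥-elim (¬Mem-∅ h)))
                   , λ x q l h → lift (¬Mem-∅ (mkMem h)))
    , unMem X∈τ̇
    , (λ u q l u∈ v q′ l′ v∈ → fromD (η λ l₁ →
         separate u (λ x → Mem x v)
       , unMem (intersection (Mem↓ (⊴-trans l₁ (mk⊴ l′)) (mkMem u∈)) (Mem↓ l₁ (mkMem v∈)))
       , λ x → (λ q″ l″ h → let h₁ , h₂ = separate⁻ Mem↓ Mem-respˡ (mkMem h) in
                            unMem h₁ , unMem (Mem-local h₂))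
             , (λ q″ l″ h → unMem (separate⁺ Mem↓ Mem-respˡ (mkMem (proj₁ h)) (mkMem (proj₂ h))))))
    , (λ s q l s⊆ → let s⊆τ̇ = mkIncl λ {x} {q′} l′ h → mkMem (s⊆ x q′ (un⊴ l′) (unMem h)) in
         fromD (η λ l₁ → union s , unMem (union-open (Incl↓ l₁ s⊆τ̇)) , λ x →
             (λ q″ l″ h → fromD (D-map (λ { _ (u , u∈s , x∈u) → u , unMem u∈s , unMem x∈u })
                                (union⁻ {s = s} (mkMem h))))
           , (λ q″ l″ h → unMem (union⁺ (Incl↓ (⊴-trans (mk⊴ l″) l₁) s⊆τ̇)
                (D-map (λ { _ (u , u∈s , x∈u) → u , mkMem u∈s , mkMem x∈u }) (toD q″ h))))))
    where
    X∈τ̇ : Mem (check X) τ̇ p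
    X∈τ̇ = let i , e = ∊-elim {a = τ} (mk∊ (proj₁ (proj₂ (proj₂ top)))) in
           Mem-respˡ (check-cong (≋-sym e)) (basic-open i)

  ⊩Basis : ∀ p → ⊩.Basis (check τ) τ̇ p
  ⊩Basis p =
      (λ b q l b∈ → unMem (Mem-local (D-map (λ { _ (i , e) → Mem-respˡ (Eq-sym e) (basic-open i) })
                            (check⁻ τ (mkMem b∈)))))
    , (λ u q l u∈ x q′ l′ x∈u → fromD (D-map
         (λ { _ (i , x∈i , i⊆) → check (τ ! i) , unMem (check⁺ τ i Eq-refl) , unMem x∈i
              , λ y q″ l″ h → unMem (include i⊆ (mk⊴ l″) (mkMem h)) })
         (neighbourhood (τ̇-open (mkMem u∈)) (mk⊴ l′) (mkMem x∈u))))

-- The strategy of II in V[G].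

module ForcedStrategy (em : ExcludedMiddle (lsuc 0ℓ)) (ac : AxiomOfChoice) (X τ P R : V)
                      (top : Topology X τ) (poset : Poset P R) (win : IIWinsRothberger X τ) where
  open Forcing P R hiding (_≤_)
  open Decide em
  open Names em P R poset
  open ForcedFormulas em P R poset
  open GeneratedTopology em X τ P R top poset
  open VStrategy em X τ win
    using (Cover; answer; answer-cong; every-neighbourhood-answered; Secured; covered; later;
           all-secured)
    renaming (cover to coverᵛ)

  private variable
    p q : Cond
    a b s d : Name

  Move : Set
  Move = Cover × Subset

  -- The set by which a move is well-ordered. A move is determined by it only up to `≋` of the cover
  -- and of the code, and this suffices: ground answers depend on covers up to `≋`, and names with
  -- the same code are forced equal.
  moveSet : Move → V
  moveSet (c , χ) = ⟪ coverᵛ c , code (subset χ) ⟫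

  open WellOrder em ac Move moveSet using (_◁_; ◁-minimal; ◁-connected)

  -- The members of V[G] are handled through V-moves: a move (c , χ) stands
  -- for II answering with the open set named by χ, chosen so as to contain
  -- the answer of the ground model strategy to the cover c.
  groundAnswer : Move → List Move → Name
  groundAnswer (c , _) t = check (τ ! answer c (map proj₁ t))

  answerName : Move → Name
  answerName (_ , χ) = subset χ

  -- Here `a` names the sequence of covers played in V[G], `t` is the past, latest move first, and
  -- the round in question is number `length t`.
  record Good (a : Name) (t : List Move) (m : Move) (p : Cond) : Set₁ where
    field
      member   : D p λ r → ∃[ 𝒰 ] (Mem (opair (num (length t)) 𝒰) a r × Mem (answerName m) 𝒰 r)
      includes : Incl (groundAnswer m t) (answerName m) p
  open Good

  Good↓ : ∀ {t m} → q ⊴ p → Good a t m p → Good a t m q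
  Good↓ l g = record { member = D↓ l (member g) ; includes = Incl↓ l (includes g) }

  -- Since `no-lower` speaks of all conditions below `p`, it says that `p` forces lower moves not to
  -- be good. Hence leastness is inherited by stronger conditions.
  record Least (a : Name) (t : List Move) (m : Move) (p : Cond) : Set₁ where
    field
      good     : Good a t m p
      no-lower : ∀ {m′ q} → m′ ◁ m → q ⊴ p → ¬ Good a t m′ q
  open Least

  data Run (a : Name) : List Move → Cond → Set₁ where
    []  : Run a [] p
    _∷_ : ∀ {t m} → Least a t m p → Run a t p → Run a (m ∷ t) p

  Run↓ : ∀ {t} → q ⊴ p → Run a t p → Run a t q
  Run↓ l []       = []
  Run↓ l (h ∷ hs) = record { good = Good↓ l (good h)
                           ; no-lower = λ m◁ l′ → no-lower h m◁ (⊴-trans l′ l) }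
                    ∷ Run↓ l hs

  Agree : ℕ → Name → Name → Cond → Set₁
  Agree n a b p = ∀ {k 𝒰 q} → k < n → q ⊴ p → Mem (opair (num k) 𝒰) a q → Mem (opair (num k) 𝒰) b q

  Good-agree : ∀ {t m} → Agree (suc (length t)) a b p → Good a t m p → Good b t m p
  Good-agree ab g = record
    { member = D-map (λ { l (𝒰 , h , k) → 𝒰 , ab ≤-refl l h , k }) (member g) ; includes = includes g }

  -- A run consults only as many entries of the sequence as it has moves, so it passes to
  -- restrictions. Agreement is required in both directions because leastness mentions `Good`
  -- negatively.
  Run-agree : ∀ {t} → Agree (length t) a b p → Agree (length t) b a p → Run a t p → Run b t p
  Run-agree ab ba []       = []
  Run-agree ab ba (_∷_ {t = t} {m = m} h hs) =
    record { good = Good-agree {t = t} {m = m} ab (good h)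
           ; no-lower = λ m◁ l g → no-lower h m◁ l
               (Good-agree {t = t} (λ k< l′ → ba k< (⊴-trans l′ l)) g) }
    ∷ Run-agree (λ k< → ab (m≤n⇒m≤1+n k<)) (λ k< → ba (m≤n⇒m≤1+n k<)) hs

  Run-resp : ∀ {t} → Eq a b p → Run a t p → Run b t p
  Run-resp e = Run-agree (λ _ l → Mem-respʳ (Eq↓ l e)) (λ _ l → Mem-respʳ (Eq-sym (Eq↓ l e)))

  infix 4 _~*_
  _~*_ : List Move → List Move → Set₁
  _~*_ = Pointwise (λ m m′ → moveSet m ≋ moveSet m′)

  Good-resp : ∀ {t t′ m} → t ~* t′ → Good a t m p → Good a t′ m p
  Good-resp {m = c , χ} t~t′ g = record
    { member = subst (λ n → D _ λ r → ∃[ 𝒰 ] (Mem (opair (num n) 𝒰) _ r × Mem _ 𝒰 r))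
                     (Pointwise-length t~t′) (member g)
    ; includes = mkIncl λ l h → include (includes g) l (Mem-respʳ (check-cong
        (answer-cong {c} {c} ≋-refl (map⁺ proj₁ proj₁ (Pointwise.map ⟪⟫-injˡ (symmetric ≋-sym t~t′))))) h) }

  -- By induction the pasts agree up to `≋`, so the two latest moves are good for the same past. As
  -- both are least, neither is `◁` the other, and `◁-connected` applies.
  Run-unique : ∀ {t t′} → length t ≡ length t′ → Run a t p → Run a t′ p → t ~* t′
  Run-unique len []       []         = []
  Run-unique len (_∷_ {t = t} {m = m} h hs) (_∷_ {t = t′} {m = m′} h′ hs′) =
    let t~t′ = Run-unique (suc-injective len) hs hs′ in
    ◁-connected m m′
      (λ m◁m′ → no-lower h′ m◁m′ ⊴-refl (Good-resp t~t′ (good h)))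
      (λ m′◁m → no-lower h m′◁m ⊴-refl (Good-resp (symmetric ≋-sym t~t′) (good h′)))
    ∷ t~t′

  CS : Name → Name → Cond → Set₁
  CS = CovSeq (check X) τ̇

  good-move : ∀ {t} → CS a d p → Mem (num (length t)) d p → D p λ r → ∃[ m ] Good a t m r
  good-move {a} {t = t} S n∈d = total (fun S) ⊴-refl n∈d >>= λ { l₁ (𝒰 , h) →
    let x , nbhd = every-neighbourhood-answered (map proj₁ t) in
    cover (covers S l₁ h) ⊴-refl (check⁺ X x Eq-refl) >>= λ { l₂ (u , u∈𝒰 , x∈u) →
    let u∈τ̇ = opens (covers S l₁ h) l₂ u∈𝒰 in
    neighbourhood (τ̇-open u∈τ̇) ⊴-refl x∈u >>= λ { l₃ (i , x∈i , i⊆u) →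
    D-map (λ { l₄ (χ , u≐χ) →
      -- Membership between checked sets descends to `V`, where the choice of `x` makes the basic
      -- set `τ ! i` the ground answer to some cover `c`.
      let c , e = nbhd i (check-∊⁻ x∈i) in
      (c , χ) , record
        { member = η λ l₅ → 𝒰 , Mem↓ (⊴-trans l₅ (⊴-trans l₄ (⊴-trans l₃ l₂))) h
                              , Mem-respˡ (Eq↓ l₅ u≐χ) (Mem↓ (⊴-trans l₅ (⊴-trans l₄ l₃)) u∈𝒰)
        ; includes = mkIncl λ l₅ k → Mem-respʳ (Eq↓ l₅ u≐χ)
            (include i⊆u (⊴-trans l₅ l₄) (Mem-respʳ (check-cong e) k)) } })
      (τ̇-subset (Mem↓ l₃ u∈τ̇)) } } }

  extend : ∀ {t} → CS a d p → Mem (num (length t)) d p → Run a t p → D p λ r → ∃[ m ] Run a (m ∷ t) r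
  extend {a} {d} {p} {t} S n∈d hs = mkD λ {q} l →
    let r , r⊴q , m , g = below (good-move {t = t} S n∈d) l
        -- The minimum is taken over the moves that some condition below `q` forces to be good, and
        -- `r₀` is such a condition for `m₀`. A condition below `r₀` is still below `q`, so it
        -- cannot make a lower move good.
        m₀ , (r₀ , r₀⊴q , g₀) , least = ◁-minimal (λ m → ∃[ r ] (r ⊴ q × Good a t m r)) (m , r , r⊴q , g)
    in r₀ , r₀⊴q , m₀ ,
       record { good = g₀ ; no-lower = λ {m′} m′◁m₀ l′ g′ → least m′ m′◁m₀ (_ , ⊴-trans l′ r₀⊴q , g′) }
       ∷ Run↓ (⊴-trans r₀⊴q l) hs

  run-exists : ∀ n → (∀ {k} → k < n → Mem (num k) d p) → CS a d p →
               D p λ r → ∃[ t ] (length t ≡ n × Run a t r)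
  run-exists zero    n⊆d S = η λ _ → [] , refl , []
  run-exists (suc n) n⊆d S = run-exists n (λ k< → n⊆d (m≤n⇒m≤1+n k<)) S >>= λ { l (t , refl , hs) →
    D-map (λ { _ (m , hs′) → m ∷ t , refl , hs′ }) (extend (CovSeq↓ l S) (Mem↓ l (n⊆d ≤-refl)) hs) }

  -- Names for the finite plays and for the strategy.

  coverset : (Subset × Cond → Bool) → Name
  coverset = sub subset

  entry : ℕ × (Subset × Cond → Bool) → Name
  entry (k , κ) = opair (num k) (coverset κ)

  Sequence : Set
  Sequence = (ℕ × (Subset × Cond → Bool)) × Cond → Bool

  sequence : Sequence → Name
  sequence = sub entry

  IsSequence : Name → Cond → Set₁
  IsSequence s p = D p λ r → ∃[ n ] CS s (num (suc n)) r

  plays : Name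
  plays = [ sequence ∣ (λ ς → IsSequence (sequence ς)) ]

  -- Nice names in three layers: an open set is a subset of `X`, a cover is a set of such subsets,
  -- and the sequence is a set of pairs of a numeral and a cover.
  Eq-sequence : ∀ n → CS s (num n) p → Eq s (sequence (nice entry s)) p
  Eq-sequence {s} n S = Eq-nice λ {y} l y∈s → graph (fun S) l y∈s >>= λ { l₁ (i , 𝒰 , i∈n , e) →
    D-map (λ { l₂ (k , _ , i≐k) →
      let C = covers S (⊴-trans l₂ (⊴-trans l₁ l)) (Mem-respˡ (Eq↓ l₂ e) (Mem↓ (⊴-trans l₂ l₁) y∈s))
      in (k , nice subset 𝒰) , Eq-trans (Eq↓ l₂ e) (opair-cong i≐k
           (Eq-nice λ l₃ u∈𝒰 → τ̇-subset (opens C l₃ u∈𝒰))) })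
      (num⁻ n i∈n) }

  plays⁺ : IsSequence s p → Mem s plays p
  plays⁺ {s = s} h = Mem-local (D-map (λ { l (n , S) →
    let e = Eq-sequence (suc n) S in
    comp⁺ {φ = λ ς → IsSequence (sequence ς)} (λ _ → D↓) (nice entry s)
      (η λ l′ → n , CovSeq↓ l′ (CovSeq-resp e Eq-refl S)) e }) h)

  plays⁻ : Mem s plays p → IsSequence s p
  plays⁻ h = comp⁻ {φ = λ ς → IsSequence (sequence ς)} (λ _ → D↓) h >>= λ { _ (ς , k , e) →
    D-map (λ { l (n , S) → n , CovSeq-resp (Eq-sym (Eq↓ l e)) Eq-refl S }) k }

  -- The graph of the strategy. The run has to use up the whole sequence, hence the domain
  -- `suc (length past)`: the answer is the latest move of the run, and shorter runs along the same
  -- sequence would give other answers.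
  record Answers (s b : Name) (p : Cond) : Set₁ where
    constructor mkAnswers
    field
      {move}    : Move
      {past}    : List Move
      sequences : CS s (num (suc (length past))) p
      runs      : Run s (move ∷ past) p
      answers   : Eq b (answerName move) p
  open Answers

  Answers↓ : q ⊴ p → Answers s b p → Answers s b q
  Answers↓ l (mkAnswers S h e) = mkAnswers (CovSeq↓ l S) (Run↓ l h) (Eq↓ l e)

  Answers-resp : ∀ {s′ b′} → Eq s s′ p → Eq b b′ p → Answers s b p → Answers s′ b′ p
  Answers-resp e e′ (mkAnswers S h k) =
    mkAnswers (CovSeq-resp e Eq-refl S) (Run-resp e h) (Eq-trans (Eq-sym e′) k)

  pair : Sequence × Subset → Name
  pair (ς , χ) = opair (sequence ς) (subset χ)

  IsPair : Sequence × Subset → Cond → Set₁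
  IsPair (ς , χ) = Answers (sequence ς) (subset χ)

  σ̇ : Name
  σ̇ = [ pair ∣ IsPair ]

  σ̇⁺ : Answers s b p → Mem (opair s b) σ̇ p
  σ̇⁺ {s = s} h@(mkAnswers {move = _ , χ} {t} S hs e) =
    let e′ = Eq-sequence (suc (length t)) S in
    comp⁺ {x = pair} {φ = IsPair} (λ _ → Answers↓) (nice entry s , χ) (Answers-resp e′ e h) (opair-cong e′ e)

  σ̇⁻ : Mem (opair s b) σ̇ p → D p (Answers s b)
  σ̇⁻ h = D-map (λ { _ ((ς , χ) , k , e) → Answers-resp (Eq-sym (opair-injˡ e)) (Eq-sym (opair-injʳ e)) k })
               (comp⁻ {x = pair} {φ = IsPair} (λ _ → Answers↓) h)

  answer-exists : ∀ {n} → CS s (num (suc n)) p →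
                  D p λ r → Σ[ h ∈ ∃ (λ b → Answers s b r) ] (length (past (proj₂ h)) ≡ n)
  answer-exists {n = n} S = run-exists (suc n) num∈num S >>= λ { l (m ∷ t , refl , hs) →
    η λ l′ → (answerName m , mkAnswers (CovSeq↓ (⊴-trans l′ l) S) (Run↓ l′ hs) Eq-refl) , refl }

  -- The domain of the sequence fixes the number of moves, so `Run-unique` identifies the latest
  -- moves as sets of `V`, and `code-cong` turns this into forced equality of the answers.
  Answers-unique : ∀ {b′} → Answers s b p → Answers s b′ p → Eq b b′ p
  Answers-unique (mkAnswers {move = m} {t} S h e) (mkAnswers {move = m′} {t′} S′ h′ e′)
    with Run-unique {t = m ∷ t} {m′ ∷ t′}
           (num-injective {k = suc (length t)} {suc (length t′)} (domain-unique (fun S) (fun S′))) h h′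
  ... | m~m′ ∷ _ = Eq-trans e (Eq-trans (code-cong _ _ (⟪⟫-injʳ m~m′)) (Eq-sym e′))

  σ̇-Fun : Fun σ̇ plays p
  σ̇-Fun = record
    { graph = λ l z∈ → D-map (λ { _ ((ς , χ) , k , e) →
        sequence ς , subset χ , plays⁺ (η λ l′ → length (past k) , CovSeq↓ l′ (sequences k)) , e })
        (comp⁻ {x = pair} {φ = IsPair} (λ _ → Answers↓) z∈)
    ; total = λ l s∈ → plays⁻ s∈ >>= λ { _ (n , S) →
        D-map (λ { _ ((b , h) , _) → b , σ̇⁺ h }) (answer-exists {n = n} S) }
    ; functional = λ l h h′ → Eq-local (σ̇⁻ h >>= λ l₁ k →
        D-map (λ l₂ k′ → Answers-unique (Answers↓ l₂ k) k′) (σ̇⁻ (Mem↓ l₁ h′)))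
    }

  ⊩Succ↓ : ∀ {n m} → q ⊴ p → ⊩.Succ n m p → ⊩.Succ n m q
  ⊩Succ↓ l h x = (λ q′ l′ → proj₁ (h x) q′ (un⊴ (⊴-trans (mk⊴ l′) l)))
               , (λ q′ l′ → proj₂ (h x) q′ (un⊴ (⊴-trans (mk⊴ l′) l)))

  ⊩Strategy : ∀ p → ⊩.Strategy (check X) τ̇ (check ω) σ̇ p
  ⊩Strategy p =
      fromD (η λ _ → plays
        , (λ s →
            (λ q l s∈ → fromD (D-map (λ { l₁ (n , S) → num n , unMem (num∈ω n)
                , fromD (η λ l₂ → num (suc n) , ⊩Succ-num⁺ Eq-refl Eq-refl , ⊩CoverSequence⁺ (CovSeq↓ l₂ S)) })
                (plays⁻ (mkMem s∈))))
          , (λ q l h → unMem (plays⁺ (toD q h >>= λ { {r} l₁ (n , n∈ω , h₁) →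
                toD r h₁ >>= λ { l₂ (m , hm , S) →
                D-map (λ { l₃ (k , e) → k , CovSeq-resp Eq-refl (⊩Succ-num⁻ e (⊩Succ↓ l₃ hm))
                                             (CovSeq↓ l₃ (⊩CoverSequence⁻ S)) })
                      (ω⁻ (Mem↓ l₂ (mkMem n∈ω))) } }))))
        , ⊩Function⁺ σ̇-Fun)
    , λ n q l n∈ω m s q₁ l₁ hm q₂ l₂ S →
        fromD (ω⁻ (Mem↓ (⊴-trans (mk⊴ l₂) (mk⊴ l₁)) (mkMem n∈ω)) >>= λ { l₃ (k , e) →
        D-map (λ { l₄ ((b , h@(mkAnswers {move = m′} {t′} _ (least ∷ _) b≐)) , refl) → b , fromD (D-map
            (λ { l₅ (𝒰 , h₁ , h₂) → 𝒰 , ⊩App⁺ (σ̇⁺ (Answers↓ l₅ h))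
               , ⊩App⁺ (Mem-respˡ (opair-cong (Eq-sym (Eq↓ (⊴-trans l₅ l₄) e)) Eq-refl) h₁)
               , unMem (Mem-respˡ (Eq-sym (Eq↓ l₅ b≐)) h₂) })
            (member {t = t′} {m = m′} (good least))) })
          (answer-exists {n = k} (CovSeq-resp Eq-refl (⊩Succ-num⁻ e (⊩Succ↓ (⊴-trans l₃ (mk⊴ l₂)) hm))
                           (CovSeq↓ l₃ (⊩CoverSequence⁻ S)))) })

  -- The named strategy wins.

  Below : ℕ → Name → Cond → Set₁
  Below n z p = D p λ r → ∃[ k ] ∃[ y ] (k < n × Eq z (opair (num k) y) r)

  Below-resp : ∀ {n} → Extensional (Below n)
  Below-resp e = D-map λ { l (k , y , k< , h) → k , y , k< , Eq-trans (Eq-sym (Eq↓ l e)) h }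

  restrict : Name → ℕ → Name
  restrict f n = separate f (Below n)

  restrict⁺ : ∀ {f n z} → Mem z f p → Below n z p → Mem z (restrict f n) p
  restrict⁺ = separate⁺ D↓ Below-resp

  restrict⁻ : ∀ {f n z} → Mem z (restrict f n) p → Mem z f p × Below n z p
  restrict⁻ {f = f} {n} h =
    let z∈f , k = separate⁻ {b = f} {φ = Below n} D↓ Below-resp h in z∈f , (k >>= λ _ k′ → k′)

  restrict-CovSeq : ∀ {f n} → CS f (check ω) p → CS (restrict f n) (num n) p
  restrict-CovSeq {f = f} {n} S = record
    { fun = record
      { graph = λ l h → D-map (λ { _ (k , y , k< , e) → num k , y , num∈num k< , e }) (proj₂ (restrict⁻ h))
      ; total = λ l x∈n → num⁻ n x∈n >>= λ { l₁ (k , k< , e) →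
          D-map (λ { l₂ (y , h) → y , restrict⁺ h
                   (η λ l₃ → k , y , k< , opair-cong (Eq↓ (⊴-trans l₃ l₂) e) Eq-refl) })
            (total (fun S) (⊴-trans l₁ l) (Mem-respˡ (Eq-sym e) (num∈ω k))) }
      ; functional = λ l h h′ → functional (fun S) l (proj₁ (restrict⁻ h)) (proj₁ (restrict⁻ h′)) }
    ; covers = λ l h → covers S l (proj₁ (restrict⁻ h)) }

  restrict-Run : ∀ {f t} → Run f t p → Run (restrict f (length t)) t p
  restrict-Run = Run-agree
    (λ {k} {𝒰} k< l h → restrict⁺ h (η λ _ → k , 𝒰 , k< , Eq-refl))
    (λ k< l h → proj₁ (restrict⁻ h))

  Captured : Name → Name → Cond → Set₁
  Captured f x p = ∃[ n ] ∃[ u ] (Mem (opair (restrict f (suc n)) u) σ̇ p × Mem x u p)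

  -- Recursion on `Secured`. At `later` the run is prolonged by whatever move is least below a
  -- stronger condition, and the tree has a branch for its ground cover. At `covered` the point lies
  -- in the latest ground answer, hence in the larger set answered in V[G].
  captures : ∀ {f j t c} → CS f (check ω) p → c ≡ map proj₁ t → Secured j c → Run f t p →
             D p (Captured f (check (X ! j)))
  captures {t = m ∷ t} S refl (covered j∊) hs@(least ∷ _) = η λ l →
    -- The run `m ∷ t` has used the rounds from 0 to `length t`, so its sequence is the restriction
    -- to `suc (length t)`.
    length t , answerName m
    , Mem↓ l (σ̇⁺ (mkAnswers {move = m} {past = t} (restrict-CovSeq S) (restrict-Run hs) Eq-refl))
    , include (includes (good least)) l (check-∊⁺ j∊)
  captures {t = t} S refl (later secured) hs =
    extend S (num∈ω (length t)) hs >>= λ { l (m , hs′) →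
    captures (CovSeq↓ l S) refl (secured (proj₁ m)) hs′ }

  ⊩Restriction : ∀ {f n m} → Eq m (num n) p → ⊩.Restriction (restrict f n) f m p
  ⊩Restriction {n = n} e z =
      (λ q l h → let z∈f , k = restrict⁻ (mkMem h) in unMem z∈f , fromD (D-map
         (λ { l₁ (k , y , k< , e′) → num k
            , unMem (Mem-respʳ (Eq-sym (Eq↓ (⊴-trans l₁ (mk⊴ l)) e)) (num∈num k<))
            , fromD (η λ l₂ → y , ⊩OPair⁺ (Eq↓ l₂ e′)) }) k))
    , (λ { q l (z∈f , h) → unMem (restrict⁺ (mkMem z∈f) (toD q h >>= λ { {r} l₁ (x , x∈m , h₁) →
         toD r h₁ >>= λ { l₂ (y , hz) →
         D-map (λ { l₃ (k , k< , e′) → k , y , k<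
                    , Eq-trans (Eq↓ l₃ (⊩OPair⁻ hz)) (opair-cong e′ Eq-refl) })
           (num⁻ n (Mem-respʳ (Eq↓ (⊴-trans l₂ (⊴-trans l₁ (mk⊴ l))) e) (Mem↓ l₂ (mkMem x∈m)))) } })) })

  ⊩Winning : ∀ p → ⊩.Winning (check X) τ̇ (check ω) σ̇ p
  ⊩Winning p f q l S x q₁ l₁ x∈X = fromD (check⁻ X (mkMem x∈X) >>= λ { l₂ (j , e) →
    D-map (λ { l₃ (n , u , h , x∈u) → num n , unMem (num∈ω n)
      , fromD (η λ l₄ → num (suc n) , fromD (η λ l₅ → restrict f (suc n) , fromD (η λ l₆ → u
      , ⊩Succ-num⁺ {k = n} Eq-refl Eq-refl , ⊩Restriction {f = f} {n = suc n} Eq-refl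
      , ⊩App⁺ (Mem↓ (⊴-trans l₆ (⊴-trans l₅ l₄)) h)
      , unMem (Mem↓ (⊴-trans l₆ (⊴-trans l₅ l₄)) (Mem-respˡ (Eq-sym (Eq↓ l₃ e)) x∈u))))) })
    (captures {f = f} {j = j} {t = []} {c = []}
      (CovSeq↓ (⊴-trans l₂ (mk⊴ l₁)) (⊩CoverSequence⁻ S)) refl (all-secured j) []) })

  ⊩IIWins⁺ : ∀ {X B T w σ} → (∀ p → ⊩.Topology X T p) → (∀ p → ⊩.Basis B T p) → (∀ p → ⊩.Omega w p) →
             (∀ p → ⊩.Strategy X T w σ p) → (∀ p → ⊩.Winning X T w σ p) →
             ∀ p → ⊩.IIWinsRothbergerGeneratedBy X B p
  ⊩IIWins⁺ {T = T} {w} {σ} topology basis omega strategy winning p q l =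
    q , un⊴ ⊴-refl , T , topology q , basis q , λ q′ l′ →
    q′ , un⊴ ⊴-refl , w , omega q′ , λ q″ l″ →
    q″ , un⊴ ⊴-refl , σ , strategy q″ , winning q″

  ⊩IIWins : ∀ p → ⊩.IIWinsRothbergerGeneratedBy (check X) (check τ) p
  ⊩IIWins = ⊩IIWins⁺ {check X} {check τ} {τ̇} {check ω} {σ̇} ⊩Topology ⊩Basis ⊩Omega ⊩Strategy ⊩Winning

theorem7p2 : ExcludedMiddle (lsuc 0ℓ) → AxiomOfChoice →
    (θ H X τ P R : V) → let open Forcing P R in
    RegularCardinal θ → IsH θ H →
    Topology X τ → ⟪ X , τ ⟫ ∈ H →
    Poset P R → ⟪ P , R ⟫ ∈ H →
    LargeEnough θ H X →
    IIWinsRothberger X τ →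
    Stationary H (λ M → Countable M × M ≺ H × ⟪ P , R ⟫ ∈ M × StronglyProperFor M) →
    ∀ p → p ⊩ ⊩.IIWinsRothbergerGeneratedBy (check X) (check τ)
theorem7p2 em ac θ H X τ P R _ _ top _ poset _ _ win _ =
  ForcedStrategy.⊩IIWins em ac X τ P R top poset win
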